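{- Let $a\ge 0$ be an integer and let $\rho=3\cdot 2^{a+1}$. Then every positive integer $n$ other than $14\cdot 2^{2a+2}$ is a sum of $4$ squares of integers in $S_\rho$. Furthermore, $14\cdot 2^{2a+2}$ is a sum of $5$ squares of integers in $S_\rho$, and hence $M(\rho)=5$.
   Context: For a positive integer $\rho$, let $S_\rho=\{n\in\mathbb{Z} : n\ge 0,\ n\neq\rho\}$ (note $0\in S_\rho$). For a positive integer $n$, let $k_\rho(n)$ be the least positive integer $m$ such that $n=x_1^2+\cdots+x_m^2$ for some $x_1,\dots,x_m\in S_\rho$, and $k_\rho(n)=\infty$ if no such $m$ exists. Let $I(\rho)=\{n\ge1 : k_\rho(n)=\infty\}$ and $M(\rho)=\max\{k_\rho(n) : n\ge 1,\ n\notin I(\rho)\}$. -}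

module Defs where

open import Data.Nat using (ℕ; zero; suc; _+_; _*_; _^_; _≤_; _<_)
open import Data.Vec using (Vec; map)
open import Data.Vec.Relation.Unary.All using (All)
open import Data.Product using (Σ; _×_; ∃)
open import Relation.Binary.PropositionalEquality using (_≡_; _≢_)
open import Relation.Nullary using (¬_)

InS : ℕ → ℕ → Set
InS ρ x = x ≢ ρ

sumSq : ∀ {m} → Vec ℕ m → ℕ
sumSq xs = Data.Vec.sum (map (λ x → x * x) xs)

SumOfSquares : ℕ → ℕ → ℕ → Set
SumOfSquares ρ m n = Σ (Vec ℕ m) λ xs → All (InS ρ) xs × sumSq xs ≡ n

HasK : ℕ → ℕ → ℕ → Set
HasK ρ n k = 1 ≤ k × SumOfSquares ρ k n × (∀ m → 1 ≤ m → m < k → ¬ SumOfSquares ρ m n)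

Finite : ℕ → ℕ → Set
Finite ρ n = Σ ℕ λ m → 1 ≤ m × SumOfSquares ρ m n

HasM : ℕ → ℕ → Set
HasM ρ M = (Σ ℕ λ n → 1 ≤ n × HasK ρ n M)
         × (∀ n k → 1 ≤ n → HasK ρ n k → k ≤ M)

{-# OPTIONS --safe #-}

-- Put ρ = 6q with q = 2^a, which is prime to 3. Start from four squares given by Lagrange's theorem. If one of the
-- entries is ρ, apply a product of reflections in vectors of norm 3 or 4 that is integral on a whole residue class of
-- representations modulo 3 or 9. The new representation contains ±ρ only on finitely many hyperplanes of the class;
-- on each of them one variable can be eliminated and the argument repeated with other reflections. Six classes suffice
-- up to order and signs, the case analysis is finite and carried out by computation, and the only line
-- that resists is spanned by (3,2,1,0), where n = 14 (ρ/3)^2. Conversely a sum of four squares divisible by 8 has even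
-- entries only, so every representation of 14·4^b comes from one of 14 and contains 3·2^b; and 14 = 4 + 4 + 4 + 1 + 1.
module Submission where

open import Defs
open import Data.Nat as ℕ using (ℕ; zero; suc; s≤s; z≤n; NonZero; _^_; _≤_; _<_)
import Data.Nat.Properties as ℕ
import Data.Nat.Divisibility as ℕ
import Data.Nat.DivMod as ℕ
open import Data.Nat.Induction using (<-rec)
open import Data.Nat.ListAction using (product)
open import Data.Nat.Primality using (Prime; euclidsLemma; prime⇒nonTrivial; prime⇒irreducible)
open import Data.Nat.Primality.Factorisation using (PrimeFactorisation; factorise)
import Data.Nat.Tactic.RingSolver as ℕ-Ring
open import Data.Fin as Fin using (Fin; toℕ; fromℕ<; splitAt; join)
import Data.Fin.Properties as Fin
open import Data.List as List using (List; []; _∷_)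
import Data.List.Relation.Unary.All as ListAll
open import Data.Maybe as Maybe using (Maybe; just; nothing; _>>=_; _<∣>_; from-just)
open import Data.Product using (Σ; ∃; ∃₂; _×_; _,_; proj₁; proj₂)
open import Data.Sum using (_⊎_; inj₁; inj₂; [_,_]′)
open import Data.Vec as Vec using (Vec; []; _∷_; map; zipWith)
import Data.Vec.Properties as Vec
open import Data.Vec.Relation.Unary.All as All using (All; []; _∷_)
import Data.Vec.Relation.Unary.All.Properties as All
open import Function using (_∘_; id)
open import Relation.Binary.Definitions using (tri<; tri≈; tri>)
open import Relation.Binary.PropositionalEquality
open import Relation.Nullary using (¬_; yes; no; contradiction; ¬?)
open import Relation.Nullary.Decidable using (from-yes; _→-dec_; _×-dec_)

-- Moving representations by reflections

module Moves where

  open import Data.Integer as ℤ using (ℤ; +_; -[1+_]; +[1+_]; _+_; _*_; _-_; -_; 0ℤ; -1ℤ; _/ℕ_)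
  import Data.Integer.Properties as ℤ
  open import Data.Integer.Tactic.RingSolver using (solve-∀)

  infix 8 _·_

  _·_ : ∀ {n} → Vec ℤ n → Vec ℤ n → ℤ
  [] · [] = 0ℤ
  (x ∷ xs) · (y ∷ ys) = x * y + xs · ys

  norm : ∀ {n} → Vec ℤ n → ℤ
  norm x = x · x

  sub : ∀ {n} → Vec ℤ n → ℤ → Vec ℤ n → Vec ℤ n
  sub u c v = zipWith (λ a b → a - c * b) u v

  sub-· : ∀ {n} (u : Vec ℤ n) c v e → sub u c v · e ≡ u · e - c * (v · e)
  sub-· [] c [] [] = lemma c
    where lemma : ∀ c → 0ℤ ≡ 0ℤ - c * 0ℤ
          lemma = solve-∀
  sub-· (a ∷ u) c (b ∷ v) (x ∷ e) rewrite sub-· u c v e = lemma a c b x (u · e) (v · e)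
    where lemma : ∀ a c b x y z → (a - c * b) * x + (y - c * z) ≡ a * x + y - c * (b * x + z)
          lemma = solve-∀

  norm-sub : ∀ {n} (x : Vec ℤ n) m k →
    norm (sub x m k) ≡ norm x - + 2 * m * (x · k) + m * m * norm k
  norm-sub [] m [] = lemma m
    where lemma : ∀ m → 0ℤ ≡ 0ℤ - + 2 * m * 0ℤ + m * m * 0ℤ
          lemma = solve-∀
  norm-sub (a ∷ x) m (b ∷ k) rewrite norm-sub x m k = lemma a b m (norm x) (x · k) (norm k)
    where lemma : ∀ a b m n i l → (a - m * b) * (a - m * b) + (n - + 2 * m * i + m * m * l) ≡
                  a * a + n - + 2 * m * (a * b + i) + m * m * (b * b + l)
          lemma = solve-∀

  scale-· : ∀ {n} c (u e : Vec ℤ n) → map (c *_) u · e ≡ c * (u · e)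
  scale-· c [] [] = sym (ℤ.*-zeroʳ c)
  scale-· c (a ∷ u) (x ∷ e) rewrite scale-· c u e = lemma c a x (u · e)
    where lemma : ∀ c a x y → c * a * x + c * y ≡ c * (a * x + y)
          lemma = solve-∀

  -- An integral linear form in `k` parameters, with value `f · e` at the point `e`. A vector of
  -- such forms is a whole family of integer vectors, so one symbolic computation treats a residue
  -- class of representations at once.
  Form : ℕ → Set
  Form = Vec ℤ

  eval : ∀ {k n} → Vec (Form k) n → Vec ℤ k → Vec ℤ n
  eval x e = map (_· e) x

  comb : ∀ {k n} → Vec ℤ n → Vec (Form k) n → Form k
  comb [] [] = Vec.replicate _ 0ℤ
  comb (c ∷ v) (f ∷ x) = sub (comb v x) (- c) f

  zero-· : ∀ {k} (e : Vec ℤ k) → Vec.replicate k 0ℤ · e ≡ 0ℤ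
  zero-· [] = refl
  zero-· (a ∷ e) rewrite zero-· e = lemma a
    where lemma : ∀ a → 0ℤ * a + 0ℤ ≡ 0ℤ
          lemma = solve-∀

  comb-· : ∀ {k n} v (x : Vec (Form k) n) e → comb v x · e ≡ eval x e · v
  comb-· [] [] e = zero-· e
  comb-· (c ∷ v) (f ∷ x) e rewrite sub-· (comb v x) (- c) f e | comb-· v x e = lemma c (f · e) (eval x e · v)
    where lemma : ∀ c a b → b - (- c) * a ≡ a * c + b
          lemma = solve-∀

  reflect : ∀ {k n} → Vec (Form k) n → Form k → Vec ℤ n → Vec (Form k) n
  reflect x g v = zipWith (λ f c → sub f c g) x v

  eval-reflect : ∀ {k n} (x : Vec (Form k) n) g v e → eval (reflect x g v) e ≡ sub (eval x e) (g · e) v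
  eval-reflect [] g [] e = refl
  eval-reflect (f ∷ x) g (c ∷ v) e = cong₂ _∷_
    (trans (sub-· f c g e) (cong (λ z → f · e - z) (ℤ.*-comm c (g · e)))) (eval-reflect x g v e)

  -- For m = v · v and m g = 2 (x · v) the map x ↦ x - g v is the reflection in the hyperplane v^⊥;
  -- divisibility of the coefficients of 2 (x · v) by m makes it integral.
  norm-reflect : ∀ {k n} (x : Vec (Form k) n) g v → map (norm v *_) g ≡ map (+ 2 *_) (comb v x) →
    ∀ e → norm (eval (reflect x g v) e) ≡ norm (eval x e)
  norm-reflect x g v eq e = begin
    norm (eval (reflect x g v) e)
      ≡⟨ cong norm (eval-reflect x g v e) ⟩
    norm (sub (eval x e) (g · e) v)
      ≡⟨ norm-sub (eval x e) (g · e) v ⟩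
    norm (eval x e) - + 2 * (g · e) * (eval x e · v) + g · e * (g · e) * norm v
      ≡⟨ factor (norm (eval x e)) (g · e) (eval x e · v) (norm v) ⟩
    norm (eval x e) + g · e * (norm v * (g · e) - + 2 * (eval x e · v))
      ≡⟨ cong (λ z → norm (eval x e) + g · e * (z - + 2 * (eval x e · v))) m·g ⟩
    norm (eval x e) + g · e * (+ 2 * (eval x e · v) - + 2 * (eval x e · v))
      ≡⟨ cancel (norm (eval x e)) (g · e) (eval x e · v) ⟩
    norm (eval x e) ∎
    where
    open ≡-Reasoning
    m·g : norm v * (g · e) ≡ + 2 * (eval x e · v)
    m·g = begin
      norm v * (g · e)             ≡⟨ scale-· (norm v) g e ⟨
      map (norm v *_) g · e        ≡⟨ cong (_· e) eq ⟩
      map (+ 2 *_) (comb v x) · e  ≡⟨ scale-· (+ 2) (comb v x) e ⟩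
      + 2 * (comb v x · e)         ≡⟨ cong (+ 2 *_) (comb-· v x e) ⟩
      + 2 * (eval x e · v)         ∎
    factor : ∀ n t w m → n - + 2 * t * w + t * t * m ≡ n + t * (m * t - + 2 * w)
    factor = solve-∀
    cancel : ∀ n t w → n + t * (+ 2 * w - + 2 * w) ≡ n
    cancel = solve-∀

  -- With the junk value 0 for division by 0. No correctness argument depends on this being the true quotient.
  quot : ℤ → ℤ → ℤ
  quot a (+ 0) = 0ℤ
  quot a +[1+ n ] = a /ℕ suc n
  quot a -[1+ n ] = - (a /ℕ suc n)

  Isometric : ∀ {k n} → Vec (Form k) n → Set
  Isometric {k} {n} x = Σ (Vec (Form k) n) λ y → ∀ e → norm (eval y e) ≡ norm (eval x e)

  -- Comparing coefficient vectors, rather than values at a point, makes the reflection in `v`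
  -- integral on all of the family. If the division by `norm v` leaves a remainder in some
  -- coefficient, the step is refused.
  step : ∀ {k n} → Vec ℤ n → (x : Vec (Form k) n) → Maybe (Isometric x)
  step v x with map (norm v *_) g ≟ map (+ 2 *_) h
    where
    h = comb v x
    g = map (λ c → quot (+ 2 * c) (norm v)) h
    _≟_ = Vec.≡-dec ℤ._≟_
  ... | yes eq = just (reflect x _ v , norm-reflect x _ v eq)
  ... | no _ = nothing

  walk : ∀ {k n} → List (Vec ℤ n) → (x : Vec (Form k) n) → Maybe (Isometric x)
  walk [] x = just (x , λ _ → refl)
  walk (v ∷ vs) x = do
    y , y≈x ← step v x
    z , z≈y ← walk vs y
    just (z , λ e → trans (z≈y e) (y≈x e))

  -- A parametrization of the integral zeros of `f` by one parameter fewer. `apply` rewrites any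
  -- form in the new parameters, and `solution` says that every zero is reached with all values
  -- preserved.
  record Elimination {k} (f : Form (suc k)) : Set where
    field
      apply : Form (suc k) → Form k
      solution : ∀ e → f · e ≡ 0ℤ → ∃ λ e′ → ∀ w → apply w · e′ ≡ w · e

  -- Euclid's algorithm on the first two coefficients, as unimodular changes of variables.
  eliminate : ∀ {k} → ℕ → (f : Form (suc k)) → Maybe (Elimination f)
  eliminate zero _ = nothing
  eliminate (suc n) (a ∷ []) with a ℤ.≟ 0ℤ
  ... | yes _ = nothing
  -- A single nonzero coefficient forces its parameter to be 0, so no parameter is left. A form that
  -- is identically zero ends in the failing branch instead.
  ... | no a≢0 = just record { apply = λ _ → [] ; solution = sol }
    where
    sol : ∀ e → (a ∷ []) · e ≡ 0ℤ → ∃ λ e′ → ∀ (w : Form 1) → [] · e′ ≡ w · e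
    sol (t ∷ []) eq with ℤ.i*j≡0⇒i≡0∨j≡0 a (trans (sym (ℤ.+-identityʳ _)) eq)
    ... | inj₁ a≡0 = contradiction a≡0 a≢0
    ... | inj₂ refl = [] , λ { (w ∷ []) → lemma w }
      where lemma : ∀ w → 0ℤ ≡ w * 0ℤ + 0ℤ
            lemma = solve-∀
  eliminate (suc n) (a ∷ b ∷ f) with a ℤ.≟ 0ℤ
  ... | yes refl = Maybe.map extend (eliminate n (b ∷ f))
    where
    extend : Elimination (b ∷ f) → Elimination (0ℤ ∷ b ∷ f)
    extend E = record
      { apply = λ { (c ∷ w) → c ∷ E.apply w }
      ; solution = λ { (t ∷ e) eq →
          let e′ , same = E.solution e (trans (lemma t _) eq)
          in t ∷ e′ , λ { (c ∷ w) → cong (λ z → c * t + z) (same w) } } }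
      where
      module E = Elimination E
      lemma : ∀ t r → r ≡ 0ℤ * t + r
      lemma = solve-∀
  -- From `a s + b t = (b - q a) t + a (s + q t)`: the new parameters are `t` and `s + q t`, and the
  -- pair of coefficients moves on by one division of Euclid's algorithm.
  ... | no _ = Maybe.map shear (eliminate n ((b - q * a) ∷ a ∷ f))
    where
    q = quot b a
    shear : Elimination ((b - q * a) ∷ a ∷ f) → Elimination (a ∷ b ∷ f)
    shear E = record
      { apply = λ { (c ∷ d ∷ w) → E.apply ((d - q * c) ∷ c ∷ w) }
      ; solution = λ { (s ∷ t ∷ e) eq →
          let e′ , same = E.solution (t ∷ (s + q * t) ∷ e) (trans (lemma q a b s t (f · e)) eq)
          in e′ , λ { (c ∷ d ∷ w) → trans (same _) (lemma q c d s t (w · e)) } } }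
      where
      module E = Elimination E
      lemma : ∀ q c d s t r → (d - q * c) * t + (c * (s + q * t) + r) ≡ c * s + (d * t + r)
      lemma = solve-∀

  -- Search for a representation avoiding ±ρ

  Avoids : ℤ → ℤ → Set
  Avoids r y = y ≢ r × y ≢ - r

  -- The right alternative is `n = 14 (r/3)^2` with the denominator cleared, the value that the
  -- reflections cannot repair.
  Outcome : ℤ → ℤ → Set
  Outcome r n = (Σ (Vec ℤ 4) λ y → All (Avoids r) y × norm y ≡ n) ⊎ + 9 * n ≡ + 14 * (r * r)

  -- Points with `ρ · e = 0` are excluded, so that a branch whose clash equations force ρ to vanish
  -- identically can be closed by `degenerate`.
  Solved : ∀ {k} → Form k → Vec (Form k) 4 → Set
  Solved ρ x = ∀ e → ρ · e ≢ 0ℤ → Outcome (ρ · e) (norm (eval x e))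

  SolvedOn : ∀ {k} → Form k → Vec (Form k) 4 → Form k → Set
  SolvedOn ρ x f = ∀ e → f · e ≡ 0ℤ → ρ · e ≢ 0ℤ → Outcome (ρ · e) (norm (eval x e))

  solved-restrict : ∀ {k} (ρ : Form (suc k)) x f (E : Elimination f) → let open Elimination E in
    Solved (apply ρ) (map apply x) → SolvedOn ρ x f
  solved-restrict ρ x f E s e fe≡0 ρe≢0 with Elimination.solution E e fe≡0
  ... | e′ , same = subst₂ Outcome (same ρ) (cong norm (eval-map x))
                      (s e′ (ρe≢0 ∘ trans (sym (same ρ))))
    where
    eval-map : ∀ {n} (x : Vec (Form _) n) → eval (map (Elimination.apply E) x) e′ ≡ eval x e
    eval-map [] = refl
    eval-map (f ∷ x) = cong₂ _∷_ (same f) (eval-map x)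

  module _ {k} (ρ : Form (suc k)) where

    clashes : Form (suc k) → Vec (Form (suc k)) 2
    clashes f = sub f (+ 1) ρ ∷ sub f (- + 1) ρ ∷ []

    -- Off the clash hyperplanes the moved family `y` itself avoids ±ρ. On a hyperplane the
    -- hypothesis concerns the original family `x`, since there a different sequence of reflections
    -- is applied to `x` afresh.
    avoid-or-solved : ∀ x {n} (y : Vec (Form (suc k)) n) → All (All (SolvedOn ρ x) ∘ clashes) y →
      ∀ e → ρ · e ≢ 0ℤ → All (Avoids (ρ · e)) (eval y e) ⊎ Outcome (ρ · e) (norm (eval x e))
    avoid-or-solved x [] [] e ρe≢0 = inj₁ []
    avoid-or-solved x (f ∷ y) ((s₊ ∷ s₋ ∷ []) ∷ s) e ρe≢0
      with sub f (+ 1) ρ · e ℤ.≟ 0ℤ | sub f (- + 1) ρ · e ℤ.≟ 0ℤ | avoid-or-solved x y s e ρe≢0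
    ... | yes eq | _ | _ = inj₂ (s₊ e eq ρe≢0)
    ... | no _ | yes eq | _ = inj₂ (s₋ e eq ρe≢0)
    ... | no _ | no _ | inj₂ o = inj₂ o
    ... | no ≢₊ | no ≢₋ | inj₁ a = inj₁ ((≢₊ ∘ clash₊ , ≢₋ ∘ clash₋) ∷ a)
      where
      clash₊ : f · e ≡ ρ · e → sub f (+ 1) ρ · e ≡ 0ℤ
      clash₊ eq rewrite sub-· f (+ 1) ρ e | eq = lemma (ρ · e)
        where lemma : ∀ r → r - + 1 * r ≡ 0ℤ
              lemma = solve-∀
      clash₋ : f · e ≡ - (ρ · e) → sub f (- + 1) ρ · e ≡ 0ℤ
      clash₋ eq rewrite sub-· f (- + 1) ρ e | eq = lemma (ρ · e)
        where lemma : ∀ r → - r - (- + 1) * r ≡ 0ℤ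
              lemma = solve-∀

  traverse : ∀ {A : Set} {P Q : A → Set} {n} {xs : Vec A n} →
    (∀ {a} → P a → Maybe (Q a)) → All P xs → Maybe (All Q xs)
  traverse h [] = just []
  traverse h (p ∷ ps) = do
    q ← h p
    qs ← traverse h ps
    just (q ∷ qs)

  generate : ∀ {A : Set} {P : A → Set} {n} → (∀ a → Maybe (P a)) → (xs : Vec A n) → Maybe (All P xs)
  generate h [] = just []
  generate h (x ∷ xs) = do
    p ← h x
    ps ← generate h xs
    just (p ∷ ps)

  -- On a one-parameter family both sides of `9 n = 14 r^2` are multiples of `t * t`, so comparing
  -- the coefficients settles every point of the line.
  exceptional : ∀ {k} (ρ : Form k) (x : Vec (Form k) 4) → Maybe (Solved ρ x)
  exceptional (r ∷ []) ((a ∷ []) ∷ (b ∷ []) ∷ (c ∷ []) ∷ (d ∷ []) ∷ [])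
    with + 9 * norm (a ∷ b ∷ c ∷ d ∷ []) ℤ.≟ + 14 * (r * r)
  ... | no _ = nothing
  ... | yes eq = just λ { (t ∷ []) _ → inj₂ (trans (lemma₁ a b c d t) (trans (cong (_* (t * t)) eq) (lemma₂ r t))) }
    where
    lemma₁ : ∀ a b c d t → let s = λ z → (z * t + 0ℤ) * (z * t + 0ℤ) in
      + 9 * (s a + (s b + (s c + (s d + 0ℤ)))) ≡ + 9 * (a * a + (b * b + (c * c + (d * d + 0ℤ)))) * (t * t)
    lemma₁ = solve-∀
    lemma₂ : ∀ r t → + 14 * (r * r) * (t * t) ≡ + 14 * ((r * t + 0ℤ) * (r * t + 0ℤ))
    lemma₂ = solve-∀
  exceptional _ _ = nothing

  degenerate : ∀ {k} (ρ : Form k) (x : Vec (Form k) 4) → Maybe (Solved ρ x)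
  degenerate ρ x with Vec.≡-dec ℤ._≟_ ρ (Vec.replicate _ 0ℤ)
  ... | no _ = nothing
  ... | yes refl = just λ e ρe≢0 → contradiction (zero-· e) ρe≢0

  Path : Set
  Path = List (Vec ℤ 4)

  fuel : ℕ
  fuel = 100

  -- A clash of a moved representation with ±ρ is a linear equation, which removes one of the k variables.
  solve : List Path → ∀ {k} (ρ : Form k) (x : Vec (Form k) 4) → Maybe (Solved ρ x)
  -- Without parameters the form ρ is zero, and the claim is vacuous.
  solve paths {zero} ρ x = degenerate ρ x
  -- There is no backtracking: only the first path whose attempt succeeds is followed, so the order
  -- of `paths` matters for the success of the search.
  solve paths {suc k} ρ x = degenerate ρ x <∣> exceptional ρ x <∣> (List.head (List.mapMaybe attempt paths) >>= conclude)
    where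
    Attempt : Set
    Attempt = Σ (Isometric x) λ i → All (All Elimination ∘ clashes ρ) (proj₁ i)

    attempt : Path → Maybe Attempt
    attempt p = do
      i ← walk p x
      -- Elimination fails on the zero form, so this rejects a path for which some moved entry is ρ
      -- or -ρ on the entire family.
      es ← generate (generate (eliminate fuel) ∘ clashes ρ) (proj₁ i)
      just (i , es)

    settle : ∀ {f} → Elimination f → Maybe (SolvedOn ρ x f)
    settle E = Maybe.map (solved-restrict ρ x _ E) (solve paths {k} (apply ρ) (map apply x))
      where open Elimination E

    conclude : Attempt → Maybe (Solved ρ x)
    conclude ((y , y≈x) , es) = do
      s ← traverse (traverse settle) es
      just λ e ρe≢0 → [ (λ a → inj₁ (eval y e , a , y≈x e)) , id ]′
                        (avoid-or-solved ρ x y s e ρe≢0)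

  module _ where
    open import Data.Integer using () renaming (0ℤ to o; 1ℤ to p; -1ℤ to m)

    -- Found by a breadth-first search over reflections in vectors of norm 3 and 4.
    paths : List Path
    paths =
      ((p ∷ p ∷ p ∷ o ∷ []) ∷ []) ∷
      ((p ∷ p ∷ m ∷ o ∷ []) ∷ []) ∷
      ((p ∷ m ∷ p ∷ o ∷ []) ∷ []) ∷
      ((p ∷ p ∷ o ∷ p ∷ []) ∷ []) ∷
      ((p ∷ o ∷ p ∷ m ∷ []) ∷ []) ∷
      ((p ∷ p ∷ o ∷ m ∷ []) ∷ []) ∷
      ((p ∷ o ∷ p ∷ p ∷ []) ∷ []) ∷
      ((p ∷ p ∷ p ∷ m ∷ []) ∷ []) ∷
      ((p ∷ p ∷ p ∷ p ∷ []) ∷ []) ∷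
      ((p ∷ o ∷ m ∷ m ∷ []) ∷ []) ∷
      ((p ∷ o ∷ p ∷ p ∷ []) ∷ (p ∷ o ∷ m ∷ p ∷ []) ∷ []) ∷
      ((o ∷ p ∷ p ∷ p ∷ []) ∷ (p ∷ o ∷ p ∷ p ∷ []) ∷ []) ∷
      ((o ∷ p ∷ p ∷ p ∷ []) ∷ (p ∷ o ∷ m ∷ m ∷ []) ∷ []) ∷
      ((o ∷ p ∷ p ∷ p ∷ []) ∷ (p ∷ p ∷ p ∷ o ∷ []) ∷ []) ∷
      ((o ∷ p ∷ p ∷ p ∷ []) ∷ (p ∷ m ∷ m ∷ o ∷ []) ∷ []) ∷
      ((p ∷ o ∷ m ∷ m ∷ []) ∷ (p ∷ o ∷ p ∷ m ∷ []) ∷ []) ∷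
      ((p ∷ o ∷ p ∷ p ∷ []) ∷ (p ∷ p ∷ o ∷ p ∷ []) ∷ []) ∷
      ((p ∷ o ∷ p ∷ p ∷ []) ∷ (p ∷ m ∷ o ∷ p ∷ []) ∷ []) ∷
      ((o ∷ p ∷ p ∷ p ∷ []) ∷ (p ∷ p ∷ o ∷ p ∷ []) ∷ []) ∷
      ((o ∷ p ∷ p ∷ p ∷ []) ∷ (p ∷ p ∷ p ∷ m ∷ []) ∷ []) ∷
      ((o ∷ p ∷ p ∷ p ∷ []) ∷ (p ∷ m ∷ o ∷ m ∷ []) ∷ []) ∷
      ((p ∷ o ∷ p ∷ p ∷ []) ∷ (o ∷ p ∷ p ∷ p ∷ []) ∷ []) ∷
      ((o ∷ p ∷ m ∷ m ∷ []) ∷ (p ∷ m ∷ p ∷ o ∷ []) ∷ (o ∷ p ∷ m ∷ p ∷ []) ∷ []) ∷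
      ((o ∷ p ∷ p ∷ p ∷ []) ∷ (p ∷ p ∷ p ∷ o ∷ []) ∷ (o ∷ p ∷ p ∷ p ∷ []) ∷ []) ∷
      ((p ∷ o ∷ p ∷ p ∷ []) ∷ (p ∷ p ∷ o ∷ p ∷ []) ∷ (p ∷ o ∷ p ∷ p ∷ []) ∷ []) ∷
      ((p ∷ o ∷ p ∷ p ∷ []) ∷ (p ∷ o ∷ m ∷ p ∷ []) ∷ (p ∷ o ∷ p ∷ m ∷ []) ∷ (o ∷ p ∷ p ∷ m ∷ []) ∷ []) ∷
      ((p ∷ o ∷ m ∷ m ∷ []) ∷ (p ∷ o ∷ m ∷ p ∷ []) ∷ (p ∷ o ∷ p ∷ m ∷ []) ∷ (o ∷ p ∷ p ∷ m ∷ []) ∷ []) ∷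
      []

  -- The residue classes of representations containing 6q

  6q : Form 4
  6q = + 6 ∷ + 0 ∷ + 0 ∷ + 0 ∷ []

  -- The variables of the forms are q = ρ / 6 and three parameters of the residue classes modulo 3 or 9 of the other entries.
  -- At least two, none, or exactly one of these are divisible by 3 in the cases A, C and B. Signs are chosen so that in
  -- case C all are ≡ q modulo 3, and in case B the last two have opposite residues modulo 3.
  configA configC : Vec (Form 4) 4
  configA = 6q ∷
    (+ 0 ∷ + 3 ∷ + 0 ∷ + 0 ∷ []) ∷
    (+ 0 ∷ + 0 ∷ + 3 ∷ + 0 ∷ []) ∷
    (+ 0 ∷ + 0 ∷ + 0 ∷ + 1 ∷ []) ∷ []
  configC = 6q ∷
    (+ 1 ∷ + 3 ∷ + 0 ∷ + 0 ∷ []) ∷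
    (+ 1 ∷ + 0 ∷ + 3 ∷ + 0 ∷ []) ∷
    (+ 1 ∷ + 0 ∷ + 0 ∷ + 3 ∷ []) ∷ []

  -- Modulo 9 the second entry is `i q`, and the last two entries add up to `(1 + j) q`. Up to signs
  -- and order, the values 0, 3 of `i` and -1, 2 of `j` exhaust case B.
  configB : ℤ → ℤ → Vec (Form 4) 4
  configB i j = 6q ∷
    (i ∷ + 9 ∷ + 0 ∷ + 0 ∷ []) ∷
    (+ 1 ∷ + 0 ∷ + 3 ∷ + 0 ∷ []) ∷
    (j ∷ + 0 ∷ - + 3 ∷ + 9 ∷ []) ∷ []

  solvedA : Solved 6q configA
  solvedA = from-just (solve paths 6q configA)

  solvedC : Solved 6q configC
  solvedC = from-just (solve paths 6q configC)

  solvedB₀₋ : Solved 6q (configB (+ 0) -1ℤ)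
  solvedB₀₋ = from-just (solve paths 6q (configB (+ 0) -1ℤ))

  solvedB₀₊ : Solved 6q (configB (+ 0) (+ 2))
  solvedB₀₊ = from-just (solve paths 6q (configB (+ 0) (+ 2)))

  solvedB₃₋ : Solved 6q (configB (+ 3) -1ℤ)
  solvedB₃₋ = from-just (solve paths 6q (configB (+ 3) -1ℤ))

  solvedB₃₊ : Solved 6q (configB (+ 3) (+ 2))
  solvedB₃₊ = from-just (solve paths 6q (configB (+ 3) (+ 2)))

-- Lagrange's four-square theorem

module Lagrange where

  open import Data.Integer as ℤ using (ℤ; +_; -[1+_]; _+_; _*_; _-_; -_; 0ℤ; 1ℤ; _/ℕ_; _%ℕ_; ∣_∣)
  import Data.Integer.Properties as ℤ
  open import Data.Integer.Tactic.RingSolver using (solve-∀)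
  open import Data.Integer.DivMod using (a≡a%ℕn+[a/ℕn]*n; n%ℕd<d)
  import Data.Integer.Divisibility.Signed as ℤ
  open Moves using (_·_; norm; sub; norm-sub)

  FourSquares : ℤ → Set
  FourSquares n = ∃ λ (x : Vec ℤ 4) → norm x ≡ n

  -- The imaginary part of the quaternion product of the second argument with the conjugate of the
  -- first. The real part is the inner product, so `euler` is the multiplicativity of the quaternion
  -- norm.
  cross : Vec ℤ 4 → Vec ℤ 4 → Vec ℤ 3
  cross (a ∷ b ∷ c ∷ d ∷ []) (x ∷ y ∷ z ∷ w ∷ []) =
    (a * y - b * x + c * w - d * z) ∷ (a * z - c * x + d * y - b * w) ∷ (a * w - d * x + b * z - c * y) ∷ []

  euler : ∀ x y → x · y * (x · y) + norm (cross x y) ≡ norm x * norm y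
  euler (a ∷ b ∷ c ∷ d ∷ []) (x ∷ y ∷ z ∷ w ∷ []) = lemma a b c d x y z w
    where
    lemma : ∀ a b c d x y z w →
      (a * x + (b * y + (c * z + (d * w + 0ℤ)))) * (a * x + (b * y + (c * z + (d * w + 0ℤ)))) +
      ((a * y - b * x + c * w - d * z) * (a * y - b * x + c * w - d * z) +
      ((a * z - c * x + d * y - b * w) * (a * z - c * x + d * y - b * w) +
      ((a * w - d * x + b * z - c * y) * (a * w - d * x + b * z - c * y) + 0ℤ))) ≡
      (a * a + (b * b + (c * c + (d * d + 0ℤ)))) * (x * x + (y * y + (z * z + (w * w + 0ℤ))))
    lemma = solve-∀

  fourSquares-* : ∀ {m n} → FourSquares m → FourSquares n → FourSquares (m * n)
  fourSquares-* (x , refl) (y , refl) = x · y ∷ cross x y , euler x y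

  -- Here `s` is the absolute value of a least absolute residue `y`. In the boundary case the sign
  -- is fixed as `y = m/2`, so that `not-all-half` meets a single linear equation per entry.
  Residue : ℕ → ℤ → ℕ → Set
  Residue m y s = y * y ≡ + (s ℕ.* s) × (2 ℕ.* s ℕ.< m ⊎ (2 ℕ.* s ≡ m × + 2 * y ≡ + m))

  subtract-quotient : ∀ m .{{_ : NonZero m}} x → x - + m * (x /ℕ m) ≡ + (x %ℕ m)
  subtract-quotient m x = trans (cong (_- + m * (x /ℕ m)) (a≡a%ℕn+[a/ℕn]*n x m)) (lemma (+ (x %ℕ m)) (x /ℕ m) (+ m))
    where
    lemma : ∀ r q m → r + q * m - m * q ≡ r
    lemma = solve-∀

  residue : ∀ m .{{_ : NonZero m}} x → ∃₂ λ k s → Residue m (x - + m * k) s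
  residue m x with ℕ.<-cmp (2 ℕ.* (x %ℕ m)) m
  ... | tri< 2r<m _ _ = x /ℕ m , x %ℕ m ,
    trans (cong (λ y → y * y) (subtract-quotient m x)) (sym (ℤ.pos-* (x %ℕ m) (x %ℕ m))) , inj₁ 2r<m
  ... | tri≈ _ 2r≡m _ = x /ℕ m , x %ℕ m ,
    trans (cong (λ y → y * y) (subtract-quotient m x)) (sym (ℤ.pos-* (x %ℕ m) (x %ℕ m))) ,
    inj₂ (2r≡m , trans (cong (+ 2 *_) (subtract-quotient m x)) (trans (sym (ℤ.pos-* 2 (x %ℕ m))) (cong +_ 2r≡m)))
  -- Rounding the quotient up turns the remainder `r` into `r - m = - s`.
  ... | tri> _ _ m<2r = 1ℤ + x /ℕ m , s , y²≡s² , inj₁ 2s<m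
    where
    r = x %ℕ m
    s = m ℕ.∸ r
    m≡r+s : m ≡ r ℕ.+ s
    m≡r+s = sym (ℕ.m+[n∸m]≡n (ℕ.<⇒≤ (n%ℕd<d x m)))
    y²≡s² : (x - + m * (1ℤ + x /ℕ m)) * (x - + m * (1ℤ + x /ℕ m)) ≡ + (s ℕ.* s)
    y²≡s² = trans (cong (λ z → (z - + m * (1ℤ + x /ℕ m)) * (z - + m * (1ℤ + x /ℕ m))) (a≡a%ℕn+[a/ℕn]*n x m))
           (trans (cong (λ z → (+ r + (x /ℕ m) * z - z * (1ℤ + x /ℕ m)) * (+ r + (x /ℕ m) * z - z * (1ℤ + x /ℕ m))) (cong +_ m≡r+s))
                  (trans (lemma (+ r) (+ s) (x /ℕ m)) (sym (ℤ.pos-* s s))))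
      where
      lemma : ∀ r s q → (r + q * (r + s) - (r + s) * (1ℤ + q)) * (r + q * (r + s) - (r + s) * (1ℤ + q)) ≡ s * s
      lemma = solve-∀
    2s<m : 2 ℕ.* s ℕ.< m
    2s<m = subst (2 ℕ.* s ℕ.<_) (sym m≡r+s)
      (subst (ℕ._< r ℕ.+ s) (cong (s ℕ.+_) (sym (ℕ.+-identityʳ s)))
        (ℕ.+-monoˡ-< s (ℕ.+-cancelˡ-< r s r (subst₂ ℕ._<_ m≡r+s (cong (r ℕ.+_) (ℕ.+-identityʳ r)) m<2r))))

  -- The induction starts from equality at the empty vector and becomes strict at the first entry
  -- smaller than m/2 in absolute value. For four entries the bound is `N < m * m`.
  residues : ∀ m .{{_ : NonZero m}} {n} (x : Vec ℤ n) → ∃₂ λ k N →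
    norm (sub x (+ m) k) ≡ + N × (4 ℕ.* N ℕ.< n ℕ.* (m ℕ.* m) ⊎
      (4 ℕ.* N ≡ n ℕ.* (m ℕ.* m) × All (λ y → + 2 * y ≡ + m) (sub x (+ m) k)))
  residues m [] = [] , 0 , refl , inj₂ (refl , [])
  residues m {suc n} (a ∷ x) with residue m a | residues m x
  ... | b , s , a²≡s² , bound | k , N , x²≡N , bounds =
    b ∷ k , s ℕ.* s ℕ.+ N , cong₂ _+_ a²≡s² x²≡N , combine bound bounds
    where
    distrib : ∀ s N → 4 ℕ.* (s ℕ.* s ℕ.+ N) ≡ 2 ℕ.* s ℕ.* (2 ℕ.* s) ℕ.+ 4 ℕ.* N
    distrib = ℕ-Ring.solve-∀
    combine : 2 ℕ.* s ℕ.< m ⊎ (2 ℕ.* s ≡ m × + 2 * (a - + m * b) ≡ + m) →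
      4 ℕ.* N ℕ.< n ℕ.* (m ℕ.* m) ⊎ (4 ℕ.* N ≡ n ℕ.* (m ℕ.* m) × All (λ y → + 2 * y ≡ + m) (sub x (+ m) k)) →
      4 ℕ.* (s ℕ.* s ℕ.+ N) ℕ.< m ℕ.* m ℕ.+ n ℕ.* (m ℕ.* m) ⊎
      (4 ℕ.* (s ℕ.* s ℕ.+ N) ≡ m ℕ.* m ℕ.+ n ℕ.* (m ℕ.* m) × All (λ y → + 2 * y ≡ + m) (a - + m * b ∷ sub x (+ m) k))
    combine bound bounds rewrite distrib s N with bound | bounds
    ... | inj₁ lt | inj₁ lt′ = inj₁ (ℕ.+-mono-< (ℕ.*-mono-< lt lt) lt′)
    ... | inj₁ lt | inj₂ (eq , _) = inj₁ (ℕ.+-mono-<-≤ (ℕ.*-mono-< lt lt) (ℕ.≤-reflexive eq))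
    ... | inj₂ (refl , _) | inj₁ lt = inj₁ (ℕ.+-monoʳ-< (m ℕ.* m) lt)
    ... | inj₂ (refl , eq) | inj₂ (eq′ , all) = inj₂ (cong (m ℕ.* m ℕ.+_) eq′ , eq ∷ all)

  square-∣∣ : ∀ a → a * a ≡ + ∣ a ∣ * + ∣ a ∣
  square-∣∣ (+ n) = refl
  square-∣∣ -[1+ n ] = refl

  norm-ℕ : ∀ {n} (x : Vec ℤ n) → norm x ≡ + Vec.sum (Vec.map (λ a → a ℕ.* a) (Vec.map ∣_∣ x))
  norm-ℕ [] = refl
  norm-ℕ (a ∷ x) = cong₂ _+_ (trans (square-∣∣ a) (sym (ℤ.pos-* ∣ a ∣ ∣ a ∣))) (norm-ℕ x)

  norm≡0 : ∀ {n} (x : Vec ℤ n) → norm x ≡ 0ℤ → All (_≡ 0ℤ) x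
  norm≡0 [] _ = []
  norm≡0 (a ∷ x) eq = ℤ.∣i∣≡0⇒i≡0 (square≡0 (ℕ.m+n≡0⇒m≡0 _ sum≡0)) ∷
                      norm≡0 x (trans (norm-ℕ x) (cong +_ (ℕ.m+n≡0⇒n≡0 (∣ a ∣ ℕ.* ∣ a ∣) sum≡0)))
    where
    sum≡0 = ℤ.+-injective (trans (sym (norm-ℕ (a ∷ x))) eq)
    square≡0 : ∀ {n} → n ℕ.* n ≡ 0 → n ≡ 0
    square≡0 {zero} _ = refl

  pos-quotient : ∀ m r N → + suc m * r ≡ + N → ∃ λ r′ → r ≡ + r′ × suc m ℕ.* r′ ≡ N
  pos-quotient m (+ r) N eq = r , refl , ℤ.+-injective (trans (ℤ.pos-* (suc m) r) eq)

  ∣-prime : ∀ {m p} → Prime p → 1 ℕ.< m → m ℕ.< p → ¬ m ℕ.∣ p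
  ∣-prime pp 1<m m<p m∣p with prime⇒irreducible pp m∣p
  ... | inj₁ refl = ℕ.<-irrefl refl 1<m
  ... | inj₂ refl = ℕ.<-irrefl refl m<p

  -- Descent on the multiplier of a prime

  module Descent {p} (pp : Prime p) where

    P : ℕ → Set
    P m = 0 ℕ.< m → m ℕ.< p → FourSquares (+ m * + p) → FourSquares (+ p)

    module Step (m-1 : ℕ) (1<m : 1 ℕ.< suc m-1) (m<p : suc m-1 ℕ.< p)
      (x : Vec ℤ 4) (x²≡mp : norm x ≡ + suc m-1 * + p) (k : Vec ℤ 4) where

      m : ℕ
      m = suc m-1

      -- With y = x - m k this is |y|²/m, and r p = (p - x · k)² + |cross x k|² by Euler's identity, without division by m².
      r : ℤ
      r = + p - + 2 * (x · k) + + m * norm k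

      mr≡y² : + m * r ≡ norm (sub x (+ m) k)
      mr≡y² = sym (trans (norm-sub x (+ m) k)
        (trans (cong (λ z → z - + 2 * + m * (x · k) + + m * + m * norm k) x²≡mp)
               (lemma (+ m) (+ p) (x · k) (norm k))))
        where
        lemma : ∀ m p i l → m * p - + 2 * m * i + m * m * l ≡ m * (p - + 2 * i + m * l)
        lemma = solve-∀

      rp : FourSquares (r * + p)
      rp = (+ p - x · k) ∷ cross x k , (begin
        (+ p - x · k) * (+ p - x · k) + norm (cross x k)
          ≡⟨ lemma₁ (+ p) (x · k) (norm (cross x k)) ⟩
        + p * + p - + 2 * + p * (x · k) + (x · k * (x · k) + norm (cross x k))
          ≡⟨ cong (λ z → + p * + p - + 2 * + p * (x · k) + z) (trans (euler x k) (cong (_* norm k) x²≡mp)) ⟩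
        + p * + p - + 2 * + p * (x · k) + + m * + p * norm k
          ≡⟨ lemma₂ (+ p) (x · k) (+ m) (norm k) ⟩
        r * + p ∎)
        where
        open ≡-Reasoning
        lemma₁ : ∀ p i c → (p - i) * (p - i) + c ≡ p * p - + 2 * p * i + (i * i + c)
        lemma₁ = solve-∀
        lemma₂ : ∀ p i m l → p * p - + 2 * p * i + m * p * l ≡ (p - + 2 * i + m * l) * p
        lemma₂ = solve-∀

      -- If `r` vanished, so would `y`, and `x = m k`. Then `x · k = m |k|²`, and the definition of
      -- `r` gives `p = m |k|²`, although `m` lies strictly between 1 and the prime `p`.
      r≢0 : r ≢ 0ℤ
      r≢0 r≡0 = ∣-prime pp 1<m m<p (ℕ.divides l (ℤ.+-injective p≡))
        where
        l = Vec.sum (Vec.map (λ a → a ℕ.* a) (Vec.map ∣_∣ k))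
        y≡0 : norm (sub x (+ m) k) ≡ 0ℤ
        y≡0 = trans (sym mr≡y²) (trans (cong (+ m *_) r≡0) (ℤ.*-zeroʳ (+ m)))
        multiple : ∀ {n} (x k : Vec ℤ n) → All (_≡ 0ℤ) (sub x (+ m) k) → x · k ≡ + m * norm k
        multiple [] [] [] = sym (ℤ.*-zeroʳ (+ m))
        multiple (a ∷ x) (b ∷ k) (eq ∷ eqs) = trans
          (cong₂ (λ u v → u * b + v) (ℤ.i-j≡0⇒i≡j a (+ m * b) eq) (multiple x k eqs))
          (lemma (+ m) b (norm k))
          where lemma : ∀ m b l → m * b * b + m * l ≡ m * (b * b + l)
                lemma = solve-∀
        p≡ : + p ≡ + (l ℕ.* m)
        p≡ = begin
          + p                                                  ≡⟨ lemma (+ p) (x · k) (+ m * norm k) ⟩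
          r + (+ 2 * (x · k) - + m * norm k)                    ≡⟨ cong₂ (λ u v → u + (+ 2 * v - + m * norm k)) r≡0 (multiple x k (norm≡0 _ y≡0)) ⟩
          0ℤ + (+ 2 * (+ m * norm k) - + m * norm k)            ≡⟨ lemma′ (+ m) (norm k) ⟩
          norm k * + m                                          ≡⟨ cong (_* + m) (norm-ℕ k) ⟩
          + l * + m                                             ≡⟨ ℤ.pos-* l m ⟨
          + (l ℕ.* m) ∎
          where
          open ≡-Reasoning
          lemma : ∀ p i l → p ≡ p - + 2 * i + l + (+ 2 * i - l)
          lemma = solve-∀
          lemma′ : ∀ m l → 0ℤ + (+ 2 * (m * l) - m * l) ≡ l * m
          lemma′ = solve-∀

      -- The only case in which |y|² < m² fails.
      not-all-half : ¬ All (λ y → + 2 * y ≡ + m) (sub x (+ m) k)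
      not-all-half all = ∣-prime pp 1<m m<p (ℤ.∣⇒∣ᵤ {+ m} {+ p} (ℤ.divides (quarters k) (p≡ x k all x²≡mp)))
        where
        double : ∀ a b → + 2 * (a - + m * b) ≡ + m → + 2 * a ≡ + m * (1ℤ + + 2 * b)
        double a b eq = trans (lemma a (+ m) b) (trans (cong (_+ + 2 * + m * b) eq) (lemma′ (+ m) b))
          where
          lemma : ∀ a m b → + 2 * a ≡ + 2 * (a - m * b) + + 2 * m * b
          lemma = solve-∀
          lemma′ : ∀ m b → m + + 2 * m * b ≡ m * (1ℤ + + 2 * b)
          lemma′ = solve-∀
        -- With `2 x = m (1 + 2 k)` in each entry, `4 m p` is `m²` times a sum of four odd squares.
        -- That sum is 4 times this integer, so `m` would divide `p`.
        quarters : Vec ℤ 4 → ℤ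
        quarters (a ∷ b ∷ c ∷ d ∷ []) = 1ℤ + (a * a + a) + (b * b + b) + (c * c + c) + (d * d + d)
        p≡ : ∀ x k → All (λ y → + 2 * y ≡ + m) (sub x (+ m) k) → norm x ≡ + m * + p → + p ≡ quarters k * + m
        p≡ (x₁ ∷ x₂ ∷ x₃ ∷ x₄ ∷ []) (k₁ ∷ k₂ ∷ k₃ ∷ k₄ ∷ []) (e₁ ∷ e₂ ∷ e₃ ∷ e₄ ∷ []) x²≡mp =
          ℤ.*-cancelˡ-≡ (+ m) _ _ (ℤ.*-cancelˡ-≡ (+ 4) _ _ (begin
            + 4 * (+ m * + p)  ≡⟨ cong (+ 4 *_) x²≡mp ⟨
            + 4 * norm (x₁ ∷ x₂ ∷ x₃ ∷ x₄ ∷ [])  ≡⟨ lemma x₁ x₂ x₃ x₄ ⟩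
            sum² (+ 2 * x₁) (+ 2 * x₂) (+ 2 * x₃) (+ 2 * x₄)
              ≡⟨ cong₂ (λ u v → u (+ 2 * x₃) v) (cong₂ sum² (double x₁ k₁ e₁) (double x₂ k₂ e₂)) (double x₄ k₄ e₄) ⟩
            sum² (+ m * (1ℤ + + 2 * k₁)) (+ m * (1ℤ + + 2 * k₂)) (+ 2 * x₃) (+ m * (1ℤ + + 2 * k₄))
              ≡⟨ cong (λ u → sum² (+ m * (1ℤ + + 2 * k₁)) (+ m * (1ℤ + + 2 * k₂)) u (+ m * (1ℤ + + 2 * k₄))) (double x₃ k₃ e₃) ⟩
            sum² (+ m * (1ℤ + + 2 * k₁)) (+ m * (1ℤ + + 2 * k₂)) (+ m * (1ℤ + + 2 * k₃)) (+ m * (1ℤ + + 2 * k₄))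
              ≡⟨ lemma′ (+ m) k₁ k₂ k₃ k₄ ⟩
            + 4 * (+ m * (quarters (k₁ ∷ k₂ ∷ k₃ ∷ k₄ ∷ []) * + m)) ∎))
          where
          open ≡-Reasoning
          sum² : ℤ → ℤ → ℤ → ℤ → ℤ
          sum² a b c d = a * a + b * b + c * c + d * d
          lemma : ∀ a b c d → + 4 * (a * a + (b * b + (c * c + (d * d + 0ℤ)))) ≡
            + 2 * a * (+ 2 * a) + + 2 * b * (+ 2 * b) + + 2 * c * (+ 2 * c) + + 2 * d * (+ 2 * d)
          lemma = solve-∀
          lemma′ : ∀ m a b c d → let o = λ z → m * (1ℤ + + 2 * z) * (m * (1ℤ + + 2 * z)) in
            o a + o b + o c + o d ≡
            + 4 * (m * ((1ℤ + (a * a + a) + (b * b + b) + (c * c + c) + (d * d + d)) * m))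
          lemma′ = solve-∀

    descent : ∀ m → P m
    descent = <-rec P step
      where
      step : ∀ m → (∀ {m′} → m′ ℕ.< m → P m′) → P m
      step 1 _ _ _ (x , x²≡p) = x , trans x²≡p (ℤ.*-identityˡ (+ p))
      step m@(suc (suc m-2)) rec _ m<p (x , x²≡mp) with residues m x
      ... | k , N , y²≡N , bound = go (pos-quotient (suc m-2) r N (trans mr≡y² y²≡N)) bound
        where
        open Step (suc m-2) (s≤s (s≤s z≤n)) m<p x x²≡mp k using (r; mr≡y²; rp; r≢0; not-all-half)
        go : (∃ λ r′ → r ≡ + r′ × m ℕ.* r′ ≡ N) → _ → FourSquares (+ p)
        go _ (inj₂ (_ , all)) = contradiction all not-all-half
        go (r′ , r≡r′ , refl) (inj₁ lt) = rec r′<m r′>0 (ℕ.<-trans r′<m m<p)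
                                            (subst (λ z → FourSquares (z * + p)) r≡r′ rp)
          where
          r′<m : r′ ℕ.< m
          r′<m = ℕ.*-cancelˡ-< m r′ m (ℕ.*-cancelˡ-< 4 (m ℕ.* r′) (m ℕ.* m) lt)
          r′>0 : 0 ℕ.< r′
          r′>0 = ℕ.n≢0⇒n>0 (λ { refl → r≢0 r≡r′ })

  -- A small multiple of an odd prime

  parity : ∀ n → ∃ λ h → n ≡ h ℕ.+ h ⊎ n ≡ suc (h ℕ.+ h)
  parity zero = 0 , inj₁ refl
  parity (suc n) with parity n
  ... | h , inj₁ refl = h , inj₂ refl
  ... | h , inj₂ refl = suc h , inj₁ (cong suc (sym (ℕ.+-suc h h)))

  %ℕ≡⇒∣ : ∀ p .{{_ : NonZero p}} a b → a %ℕ p ≡ b %ℕ p → + p ℤ.∣ (a - b)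
  %ℕ≡⇒∣ p a b eq = ℤ.divides (a /ℕ p - b /ℕ p) (begin
    a - b
      ≡⟨ cong₂ _-_ (a≡a%ℕn+[a/ℕn]*n a p) (a≡a%ℕn+[a/ℕn]*n b p) ⟩
    + (a %ℕ p) + (a /ℕ p) * + p - (+ (b %ℕ p) + (b /ℕ p) * + p)
      ≡⟨ cong (λ z → + z + (a /ℕ p) * + p - (+ (b %ℕ p) + (b /ℕ p) * + p)) eq ⟩
    + (b %ℕ p) + (a /ℕ p) * + p - (+ (b %ℕ p) + (b /ℕ p) * + p)
      ≡⟨ lemma (+ (b %ℕ p)) (a /ℕ p) (b /ℕ p) (+ p) ⟩
    (a /ℕ p - b /ℕ p) * + p ∎)
    where
    open ≡-Reasoning
    lemma : ∀ r u v p → r + u * p - (r + v * p) ≡ (u - v) * p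
    lemma = solve-∀

  module OddPrime {h} (pp : Prime (suc (h ℕ.+ h))) where

    p : ℕ
    p = suc (h ℕ.+ h)

    -- Both factors of `x² - y² = (x - y)(x + y)` are positive and at most `2h`, hence below `p`.
    squares-distinct : ∀ {x y} → x ℕ.≤ h → y ℕ.< x → ¬ + p ℤ.∣ (+ x * + x - + y * + y)
    squares-distinct {x} {y} x≤h y<x p∣ with euclidsLemma (x ℕ.∸ y) (x ℕ.+ y) pp (subst (p ℕ.∣_) abs (ℤ.∣⇒∣ᵤ p∣))
      where
      x≡ : x ≡ (x ℕ.∸ y) ℕ.+ y
      x≡ = sym (ℕ.m∸n+n≡m (ℕ.<⇒≤ y<x))
      lemma : ∀ d y → (d + y) * (d + y) - y * y ≡ d * (d + y + y)
      lemma = solve-∀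
      abs : ∣ + x * + x - + y * + y ∣ ≡ (x ℕ.∸ y) ℕ.* (x ℕ.+ y)
      abs = begin
        ∣ + x * + x - + y * + y ∣ ≡⟨ cong (λ z → ∣ + z * + z - + y * + y ∣) x≡ ⟩
        ∣ + d⁺ * + d⁺ - + y * + y ∣ ≡⟨ cong ∣_∣ (lemma (+ (x ℕ.∸ y)) (+ y)) ⟩
        ∣ + (x ℕ.∸ y) * + (d⁺ ℕ.+ y) ∣ ≡⟨ ℤ.abs-* (+ (x ℕ.∸ y)) (+ (d⁺ ℕ.+ y)) ⟩
        (x ℕ.∸ y) ℕ.* (d⁺ ℕ.+ y) ≡⟨ cong (λ z → (x ℕ.∸ y) ℕ.* (z ℕ.+ y)) x≡ ⟨
        (x ℕ.∸ y) ℕ.* (x ℕ.+ y) ∎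
        where
        open ≡-Reasoning
        d⁺ = (x ℕ.∸ y) ℕ.+ y
    ... | inj₁ p∣x-y = ℕ.>⇒∤ {{ℕ.>-nonZero (ℕ.m<n⇒0<n∸m y<x)}}
                        (s≤s (ℕ.≤-trans (ℕ.m∸n≤m x y) (ℕ.≤-trans x≤h (ℕ.m≤m+n h h)))) p∣x-y
    ... | inj₂ p∣x+y = ℕ.>⇒∤ {{ℕ.>-nonZero (ℕ.≤-trans (s≤s z≤n) (ℕ.≤-trans y<x (ℕ.m≤m+n x y)))}}
                        (s≤s (ℕ.+-mono-≤ x≤h (ℕ.<⇒≤ (ℕ.<-≤-trans y<x x≤h)))) p∣x+y

    squares-injective : ∀ {x y} → x ℕ.≤ h → y ℕ.≤ h → + p ℤ.∣ (+ x * + x - + y * + y) → x ≡ y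
    squares-injective {x} {y} x≤h y≤h p∣ with ℕ.<-cmp x y
    ... | tri≈ _ x≡y _ = x≡y
    ... | tri> _ _ y<x = contradiction p∣ (squares-distinct x≤h y<x)
    ... | tri< x<y _ _ = contradiction (subst (+ p ℤ.∣_) (lemma (+ x) (+ y)) (ℤ.∣m⇒∣-m p∣)) (squares-distinct y≤h x<y)
      where lemma : ∀ x y → - (x * x - y * y) ≡ y * y - x * x
            lemma = solve-∀

    -- The squares and the numbers `-1 - y²`, for arguments from 0 to `h`: together `2h + 2` values
    -- for `2h + 1` residue classes.
    value : Fin (suc h) ⊎ Fin (suc h) → ℤ
    value (inj₁ i) = + toℕ i * + toℕ i
    value (inj₂ i) = - (1ℤ + + toℕ i * + toℕ i)

    toℕ≤h : (i : Fin (suc h)) → toℕ i ℕ.≤ h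
    toℕ≤h i = ℕ.≤-pred (Fin.toℕ<n i)

    collide : ∀ i j → i ≢ j → + p ℤ.∣ (value i - value j) →
      ∃₂ λ x y → x ℕ.≤ h × y ℕ.≤ h × + p ℤ.∣ + (x ℕ.* x ℕ.+ y ℕ.* y ℕ.+ 1)
    collide (inj₁ i) (inj₁ j) i≢j p∣ =
      contradiction (cong inj₁ (Fin.toℕ-injective (squares-injective (toℕ≤h i) (toℕ≤h j) p∣))) i≢j
    collide (inj₂ i) (inj₂ j) i≢j p∣ =
      contradiction (cong inj₂ (Fin.toℕ-injective (sym (squares-injective (toℕ≤h j) (toℕ≤h i)
        (subst (+ p ℤ.∣_) (lemma (+ toℕ i) (+ toℕ j)) p∣))))) i≢j
      where lemma : ∀ x y → - (1ℤ + x * x) - - (1ℤ + y * y) ≡ y * y - x * x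
            lemma = solve-∀
    collide (inj₁ i) (inj₂ j) _ p∣ = toℕ i , toℕ j , toℕ≤h i , toℕ≤h j , subst (+ p ℤ.∣_)
      (trans (lemma (+ toℕ i) (+ toℕ j)) (sym (cong₂ (λ u v → u + v + 1ℤ) (ℤ.pos-* (toℕ i) (toℕ i)) (ℤ.pos-* (toℕ j) (toℕ j))))) p∣
      where lemma : ∀ x y → x * x - - (1ℤ + y * y) ≡ x * x + y * y + 1ℤ
            lemma = solve-∀
    collide (inj₂ i) (inj₁ j) _ p∣ = toℕ i , toℕ j , toℕ≤h i , toℕ≤h j , subst (+ p ℤ.∣_)
      (trans (lemma (+ toℕ i) (+ toℕ j)) (sym (cong₂ (λ u v → u + v + 1ℤ) (ℤ.pos-* (toℕ i) (toℕ i)) (ℤ.pos-* (toℕ j) (toℕ j))))) (ℤ.∣m⇒∣-m p∣)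
      where lemma : ∀ x y → - (- (1ℤ + x * x) - y * y) ≡ x * x + y * y + 1ℤ
            lemma = solve-∀

    -- Each half of `value` is injective modulo `p`, so the pigeonhole collision is between the
    -- halves and gives `x² + y² + 1 = m p`. As `x` and `y` are at most `h`, the sum is below `p²`,
    -- whence `m < p`.
    small-multiple : ∃ λ m → 0 ℕ.< m × m ℕ.< p × FourSquares (+ m * + p)
    small-multiple with Fin.pigeonhole (s≤s (ℕ.≤-reflexive (sym (ℕ.+-suc h h)))) residueOf
      where
      residueOf : Fin (suc h ℕ.+ suc h) → Fin p
      residueOf i = fromℕ< (n%ℕd<d (value (splitAt (suc h) i)) p)
    ... | i , j , i<j , same with collide (splitAt (suc h) i) (splitAt (suc h) j) distinct
            (%ℕ≡⇒∣ p (value (splitAt (suc h) i)) (value (splitAt (suc h) j)) (Fin.fromℕ<-injective _ _ (n%ℕd<d (value (splitAt (suc h) i)) p) (n%ℕd<d (value (splitAt (suc h) j)) p) same))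
      where
      distinct : splitAt (suc h) i ≢ splitAt (suc h) j
      distinct eq = Fin.<⇒≢ i<j (trans (sym (Fin.join-splitAt (suc h) (suc h) i))
                      (trans (cong (join (suc h) (suc h)) eq) (Fin.join-splitAt (suc h) (suc h) j)))
    ... | x , y , x≤h , y≤h , p∣ with ℤ.∣⇒∣ᵤ p∣
    ... | ℕ.divides m eq = m , m>0 , m<p , + x ∷ + y ∷ + 1 ∷ + 0 ∷ [] , (begin
        + x * + x + (+ y * + y + 1ℤ)  ≡⟨ lemma (+ x) (+ y) ⟩
        + x * + x + + y * + y + 1ℤ    ≡⟨ cong₂ (λ u v → u + v + 1ℤ) (ℤ.pos-* x x) (ℤ.pos-* y y) ⟨
        + (x ℕ.* x ℕ.+ y ℕ.* y ℕ.+ 1) ≡⟨ cong +_ eq ⟩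
        + (m ℕ.* p)                   ≡⟨ ℤ.pos-* m p ⟩
        + m * + p ∎)
      where
      open ≡-Reasoning
      lemma : ∀ x y → x * x + (y * y + 1ℤ) ≡ x * x + y * y + 1ℤ
      lemma = solve-∀
      m>0 : 0 ℕ.< m
      m>0 = ℕ.n≢0⇒n>0 λ { refl → contradiction (trans (ℕ.+-comm 1 (x ℕ.* x ℕ.+ y ℕ.* y)) eq) λ () }
      square-bound : x ℕ.* x ℕ.+ y ℕ.* y ℕ.+ 1 ℕ.< p ℕ.* p
      square-bound = ℕ.≤-<-trans (ℕ.+-monoˡ-≤ 1 (ℕ.+-mono-≤ (ℕ.*-mono-≤ x≤h x≤h) (ℕ.*-mono-≤ y≤h y≤h)))
        (subst (h ℕ.* h ℕ.+ h ℕ.* h ℕ.+ 1 ℕ.<_) (sym (expand h))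
          (ℕ.m<m+n (h ℕ.* h ℕ.+ h ℕ.* h ℕ.+ 1) (ℕ.<-≤-trans 0<h (ℕ.m≤m+n h _))))
        where
        expand : ∀ h → suc (h ℕ.+ h) ℕ.* suc (h ℕ.+ h) ≡ (h ℕ.* h ℕ.+ h ℕ.* h ℕ.+ 1) ℕ.+ (h ℕ.+ (3 ℕ.* h ℕ.+ 2 ℕ.* h ℕ.* h))
        expand = ℕ-Ring.solve-∀
        0<h : 0 ℕ.< h
        0<h = ℕ.n≢0⇒n>0 λ { refl → contradiction (ℕ.nonTrivial⇒n>1 1 {{prime⇒nonTrivial pp}}) (ℕ.<-irrefl refl) }
      m<p : m ℕ.< p
      m<p = ℕ.*-cancelʳ-< p m p (subst (ℕ._< p ℕ.* p) eq square-bound)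

    fourSquares : FourSquares (+ p)
    fourSquares = let m , 0<m , m<p , mp = small-multiple in Descent.descent pp m 0<m m<p mp

  fourSquares-prime : ∀ {p} → Prime p → FourSquares (+ p)
  fourSquares-prime {p} pp with parity p
  ... | h , inj₂ refl = OddPrime.fourSquares {h} pp
  ... | h , inj₁ refl with prime⇒irreducible pp (ℕ.divides h (trans (cong (h ℕ.+_) (sym (ℕ.+-identityʳ h))) (ℕ.*-comm 2 h)))
  ...   | inj₂ 2≡p = subst (FourSquares ∘ +_) 2≡p (+ 1 ∷ + 1 ∷ + 0 ∷ + 0 ∷ [] , refl)

  lagrange : ∀ n → FourSquares (+ n)
  lagrange zero = + 0 ∷ + 0 ∷ + 0 ∷ + 0 ∷ [] , refl
  lagrange n@(suc _) = subst (FourSquares ∘ +_) (sym isFactorisation) (fourSquares-product factorsPrime)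
    where
    open PrimeFactorisation (factorise n)
    fourSquares-product : ∀ {ps} → ListAll.All Prime ps → FourSquares (+ product ps)
    fourSquares-product ListAll.[] = + 1 ∷ + 0 ∷ + 0 ∷ + 0 ∷ [] , refl
    fourSquares-product {p ∷ ps} (pp ListAll.∷ pps) =
      subst FourSquares (sym (ℤ.pos-* p (product ps))) (fourSquares-* (fourSquares-prime pp) (fourSquares-product pps))

-- Replacing the entry ρ

module Replacement where

  open import Data.Integer as ℤ using (ℤ; +_; -[1+_]; _+_; _*_; _-_; -_; 0ℤ; 1ℤ; _/ℕ_; _%ℕ_; ∣_∣)
  import Data.Integer.Properties as ℤ
  open import Data.Integer.Tactic.RingSolver using (solve-∀)
  open import Data.Integer.DivMod using (a≡a%ℕn+[a/ℕn]*n; n%ℕd<d)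
  open Moves
  open Lagrange

  -- Classes are measured against `q` instead of 1, because `q` is a parameter of the solved
  -- families. This is possible as `q` is prime to 3.
  data Residue₃ (q z : ℤ) : Set where
    multiple : ∀ w → z ≡ + 3 * w → Residue₃ q z
    plus     : ∀ w → z ≡ q + + 3 * w → Residue₃ q z
    minus    : ∀ w → z ≡ - q + + 3 * w → Residue₃ q z

  Unit₃ : ℤ → Set
  Unit₃ q = ∃ λ u → q ≡ 1ℤ + + 3 * u ⊎ q ≡ - 1ℤ + + 3 * u

  unit₃-2^ : ∀ a → Unit₃ (+ (2 ^ a))
  unit₃-2^ zero = 0ℤ , inj₁ refl
  unit₃-2^ (suc a) with unit₃-2^ a
  ... | u , inj₁ eq = 1ℤ + + 2 * u , inj₂ (trans (ℤ.pos-* 2 (2 ^ a)) (trans (cong (+ 2 *_) eq) (lemma u)))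
    where lemma : ∀ u → + 2 * (1ℤ + + 3 * u) ≡ - 1ℤ + + 3 * (1ℤ + + 2 * u)
          lemma = solve-∀
  ... | u , inj₂ eq = - 1ℤ + + 2 * u , inj₁ (trans (ℤ.pos-* 2 (2 ^ a)) (trans (cong (+ 2 *_) eq) (lemma u)))
    where lemma : ∀ u → + 2 * (- 1ℤ + + 3 * u) ≡ 1ℤ + + 3 * (- 1ℤ + + 2 * u)
          lemma = solve-∀

  residue₃ : ∀ {q} → Unit₃ q → ∀ z → Residue₃ q z
  residue₃ q≡ z with z %ℕ 3 | z /ℕ 3 | n%ℕd<d z 3 | a≡a%ℕn+[a/ℕn]*n z 3
  ... | 0 | w | _ | eq = multiple w (trans eq (lemma w))
    where lemma : ∀ w → 0ℤ + w * + 3 ≡ + 3 * w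
          lemma = solve-∀
  residue₃ (u , inj₁ refl) z | 1 | w | _ | eq = plus (w - u) (trans eq (lemma w u))
    where lemma : ∀ w u → 1ℤ + w * + 3 ≡ 1ℤ + + 3 * u + + 3 * (w - u)
          lemma = solve-∀
  residue₃ (u , inj₂ refl) z | 1 | w | _ | eq = minus (w + u) (trans eq (lemma w u))
    where lemma : ∀ w u → 1ℤ + w * + 3 ≡ - (- 1ℤ + + 3 * u) + + 3 * (w + u)
          lemma = solve-∀
  residue₃ (u , inj₁ refl) z | 2 | w | _ | eq = minus (1ℤ + w + u) (trans eq (lemma w u))
    where lemma : ∀ w u → + 2 + w * + 3 ≡ - (1ℤ + + 3 * u) + + 3 * (1ℤ + w + u)
          lemma = solve-∀
  residue₃ (u , inj₂ refl) z | 2 | w | _ | eq = plus (1ℤ + w - u) (trans eq (lemma w u))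
    where lemma : ∀ w u → + 2 + w * + 3 ≡ - 1ℤ + + 3 * u + + 3 * (1ℤ + w - u)
          lemma = solve-∀
  residue₃ _ z | suc (suc (suc _)) | _ | s≤s (s≤s (s≤s ())) | _

  -- Passing to squares merges the classes of `q` and `- q`.
  data Square₃ (q : ℤ) : ℤ → Set where
    multiple : ∀ w → Square₃ q (+ 3 * w * (+ 3 * w))
    unit     : ∀ w → Square₃ q ((q + + 3 * w) * (q + + 3 * w))

  square₃ : ∀ {q} → Unit₃ q → ∀ z → Square₃ q (z * z)
  square₃ {q} u z with residue₃ u z
  ... | multiple w refl = multiple w
  ... | plus w refl = unit w
  ... | minus w refl = subst (Square₃ q) (lemma q w) (unit (- w))
    where lemma : ∀ q w → (q + + 3 * - w) * (q + + 3 * - w) ≡ (- q + + 3 * w) * (- q + + 3 * w)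
          lemma = solve-∀

  module Replace (q : ℤ) (q≢0 : q ≢ 0ℤ) (q-unit : Unit₃ q) where

    -- Indexed by the squares of the other three entries, so that signs may be chosen freely and
    -- reordering is a rearrangement of a sum.
    Replaceable : ℤ → ℤ → ℤ → Set
    Replaceable s t u = Outcome (+ 6 * q) (+ 6 * q * (+ 6 * q) + s + t + u)

    swap₁₂ : ∀ {s t u} → Replaceable s t u → Replaceable t s u
    swap₁₂ {s} {t} {u} = subst (Outcome _) (lemma (+ 6 * q * (+ 6 * q)) s t u)
      where lemma : ∀ k s t u → k + s + t + u ≡ k + t + s + u
            lemma = solve-∀

    swap₂₃ : ∀ {s t u} → Replaceable s t u → Replaceable s u t
    swap₂₃ {s} {t} {u} = subst (Outcome _) (lemma (+ 6 * q * (+ 6 * q)) s t u)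
      where lemma : ∀ k s t u → k + s + t + u ≡ k + s + u + t
            lemma = solve-∀

    sq : ℤ → ℤ
    sq z = z * z

    6q-eval : ∀ b c d → 6q · (q ∷ b ∷ c ∷ d ∷ []) ≡ + 6 * q
    6q-eval b c d = lemma q b c d
      where lemma : ∀ q b c d → + 6 * q + (+ 0 * b + (+ 0 * c + (+ 0 * d + 0ℤ))) ≡ + 6 * q
            lemma = solve-∀

    instantiate : ∀ f g h → Solved 6q (6q ∷ f ∷ g ∷ h ∷ []) → ∀ b c d → let e = q ∷ b ∷ c ∷ d ∷ [] in
      ∀ {s t u} → f · e ≡ s → g · e ≡ t → h · e ≡ u → Replaceable (sq s) (sq t) (sq u)
    instantiate f g h solved b c d refl refl refl =
      subst₂ Outcome (6q-eval b c d)
        (trans (cong (λ z → z * z + (sq (f · e) + (sq (g · e) + (sq (h · e) + 0ℤ)))) (6q-eval b c d))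
               (lemma (sq (+ 6 * q)) (sq (f · e)) (sq (g · e)) (sq (h · e))))
        (solved e 6qe≢0)
      where
      e = q ∷ b ∷ c ∷ d ∷ []
      lemma : ∀ r s t u → r + (s + (t + (u + 0ℤ))) ≡ r + s + t + u
      lemma = solve-∀
      6qe≢0 : 6q · e ≢ 0ℤ
      6qe≢0 eq with ℤ.i*j≡0⇒i≡0∨j≡0 (+ 6) (trans (sym (6q-eval b c d)) eq)
      ... | inj₂ q≡0 = q≢0 q≡0

    caseA : ∀ b c d → Replaceable (sq (+ 3 * b)) (sq (+ 3 * c)) (sq d)
    caseA b c d = instantiate _ _ _ solvedA b c d (lemma₁ q b c d) (lemma₂ q b c d) (lemma₃ q b c d)
      where
      lemma₁ : ∀ q b c d → + 0 * q + (+ 3 * b + (+ 0 * c + (+ 0 * d + 0ℤ))) ≡ + 3 * b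
      lemma₁ = solve-∀
      lemma₂ : ∀ q b c d → + 0 * q + (+ 0 * b + (+ 3 * c + (+ 0 * d + 0ℤ))) ≡ + 3 * c
      lemma₂ = solve-∀
      lemma₃ : ∀ q b c d → + 0 * q + (+ 0 * b + (+ 0 * c + (+ 1 * d + 0ℤ))) ≡ d
      lemma₃ = solve-∀

    caseC : ∀ b c d → Replaceable (sq (q + + 3 * b)) (sq (q + + 3 * c)) (sq (q + + 3 * d))
    caseC b c d = instantiate _ _ _ solvedC b c d (lemma₁ q b c d) (lemma₂ q b c d) (lemma₃ q b c d)
      where
      lemma₁ : ∀ q b c d → + 1 * q + (+ 3 * b + (+ 0 * c + (+ 0 * d + 0ℤ))) ≡ q + + 3 * b
      lemma₁ = solve-∀
      lemma₂ : ∀ q b c d → + 1 * q + (+ 0 * b + (+ 3 * c + (+ 0 * d + 0ℤ))) ≡ q + + 3 * c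
      lemma₂ = solve-∀
      lemma₃ : ∀ q b c d → + 1 * q + (+ 0 * b + (+ 0 * c + (+ 3 * d + 0ℤ))) ≡ q + + 3 * d
      lemma₃ = solve-∀

    caseB : ∀ i j → Solved 6q (configB i j) → ∀ d b w →
      Replaceable (sq (i * q + + 9 * d)) (sq (q + + 3 * b)) (sq (j * q - + 3 * b + + 9 * w))
    caseB i j solved d b w = instantiate _ _ _ solved d b w (lemma₁ i q d b w) (lemma₂ q d b w) (lemma₃ j q d b w)
      where
      lemma₁ : ∀ i q d b w → i * q + (+ 9 * d + (+ 0 * b + (+ 0 * w + 0ℤ))) ≡ i * q + + 9 * d
      lemma₁ = solve-∀
      lemma₂ : ∀ q d b w → + 1 * q + (+ 0 * d + (+ 3 * b + (+ 0 * w + 0ℤ))) ≡ q + + 3 * b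
      lemma₂ = solve-∀
      lemma₃ : ∀ j q d b w → j * q + (+ 0 * d + (-[1+ 2 ] * b + (+ 9 * w + 0ℤ))) ≡ j * q - + 3 * b + + 9 * w
      lemma₃ = solve-∀

    -- Up to sign, a multiple of 3 is 0 or `3 q` modulo 9, which accounts for the two values of `i`
    -- in case B.
    data Square₉ : ℤ → Set where
      square₉ : ∀ i → i ≡ + 0 ⊎ i ≡ + 3 → ∀ d → Square₉ (sq (i * q + + 9 * d))

    tripled : ∀ z → Square₉ (sq (+ 3 * z))
    tripled z with residue₃ q-unit z
    ... | multiple w refl = subst Square₉ (lemma q w) (square₉ (+ 0) (inj₁ refl) w)
      where lemma : ∀ q w → (+ 0 * q + + 9 * w) * (+ 0 * q + + 9 * w) ≡ + 3 * (+ 3 * w) * (+ 3 * (+ 3 * w))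
            lemma = solve-∀
    ... | plus w refl = subst Square₉ (lemma q w) (square₉ (+ 3) (inj₂ refl) w)
      where lemma : ∀ q w → (+ 3 * q + + 9 * w) * (+ 3 * q + + 9 * w) ≡ + 3 * (q + + 3 * w) * (+ 3 * (q + + 3 * w))
            lemma = solve-∀
    ... | minus w refl = subst Square₉ (lemma q w) (square₉ (+ 3) (inj₂ refl) (- w))
      where lemma : ∀ q w → (+ 3 * q + + 9 * - w) * (+ 3 * q + + 9 * - w) ≡ + 3 * (- q + + 3 * w) * (+ 3 * (- q + + 3 * w))
            lemma = solve-∀

    caseB₋ : ∀ {s} → Square₉ s → ∀ b w → Replaceable s (sq (q + + 3 * b)) (sq (- + 1 * q - + 3 * b + + 9 * w))
    caseB₋ (square₉ i (inj₁ refl) d) = caseB i (- + 1) solvedB₀₋ d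
    caseB₋ (square₉ i (inj₂ refl) d) = caseB i (- + 1) solvedB₃₋ d

    caseB₊ : ∀ {s} → Square₉ s → ∀ b w → Replaceable s (sq (q + + 3 * b)) (sq (+ 2 * q - + 3 * b + + 9 * w))
    caseB₊ (square₉ i (inj₁ refl) d) = caseB i (+ 2) solvedB₀₊ d
    caseB₊ (square₉ i (inj₂ refl) d) = caseB i (+ 2) solvedB₃₊ d

    difference : ∀ b c {v} → b - c ≡ v → c ≡ b - v
    difference b c refl = ring b c
      where ring : ∀ b c → c ≡ b - (b - c)
            ring = solve-∀

    -- The last entry is taken with the opposite sign: `-(q + 3c)` is `-q - 3b + 9w` if
    -- `b - c = 3w`, and `2q - 3b + 9w` if `b - c = q + 3w`. In the remaining class the two entries
    -- trade places, which negates `b - c`.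
    one-multiple : ∀ d b c → Replaceable (sq (+ 3 * d)) (sq (q + + 3 * b)) (sq (q + + 3 * c))
    one-multiple d b c with residue₃ q-unit (b - c)
    ... | multiple w eq = subst (Replaceable _ _) (trans (lemma q b w) (cong (λ z → sq (q + + 3 * z)) (sym (difference b c eq))))
                            (caseB₋ (tripled d) b w)
      where
      lemma : ∀ q b w → (- + 1 * q - + 3 * b + + 9 * w) * (- + 1 * q - + 3 * b + + 9 * w) ≡ (q + + 3 * (b - + 3 * w)) * (q + + 3 * (b - + 3 * w))
      lemma = solve-∀
    ... | plus w eq = subst (Replaceable _ _) (trans (lemma q b w) (cong (λ z → sq (q + + 3 * z)) (sym (difference b c eq))))
                        (caseB₊ (tripled d) b w)
      where
      lemma : ∀ q b w → (+ 2 * q - + 3 * b + + 9 * w) * (+ 2 * q - + 3 * b + + 9 * w) ≡ (q + + 3 * (b - (q + + 3 * w))) * (q + + 3 * (b - (q + + 3 * w)))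
      lemma = solve-∀
    ... | minus w eq = swap₂₃ (subst (Replaceable _ _) (trans (lemma q c w) (cong (λ z → sq (q + + 3 * z)) (sym (difference c b c-b))))
                        (caseB₊ (tripled d) c (- w)))
      where
      c-b : c - b ≡ q + + 3 * - w
      c-b = trans (negate b c) (trans (cong -_ eq) (negate-plus q w))
        where
        negate : ∀ b c → c - b ≡ - (b - c)
        negate = solve-∀
        negate-plus : ∀ q w → - (- q + + 3 * w) ≡ q + + 3 * - w
        negate-plus = solve-∀
      lemma : ∀ q c w → (+ 2 * q - + 3 * c + + 9 * - w) * (+ 2 * q - + 3 * c + + 9 * - w) ≡ (q + + 3 * (c - (q + + 3 * - w))) * (q + + 3 * (c - (q + + 3 * - w)))
      lemma = solve-∀

    replaceable : ∀ b c d → Replaceable (sq b) (sq c) (sq d)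
    replaceable b c d = go (square₃ q-unit b) (square₃ q-unit c) (square₃ q-unit d)
      where
      go : ∀ {s t u} → Square₃ q s → Square₃ q t → Square₃ q u → Replaceable s t u
      go (multiple b) (multiple c) (multiple d) = caseA b c (+ 3 * d)
      go (multiple b) (multiple c) (unit d) = caseA b c (q + + 3 * d)
      go (multiple b) (unit c) (multiple d) = swap₂₃ (caseA b d (q + + 3 * c))
      go (unit b) (multiple c) (multiple d) = swap₁₂ (swap₂₃ (caseA c d (q + + 3 * b)))
      go (multiple b) (unit c) (unit d) = one-multiple b c d
      go (unit b) (multiple c) (unit d) = swap₁₂ (one-multiple c b d)
      go (unit b) (unit c) (multiple d) = swap₂₃ (swap₁₂ (one-multiple d b c))
      go (unit b) (unit c) (unit d) = caseC b c d

  ∣∣≡⇒≡± : ∀ z {r} → ∣ z ∣ ≡ r → z ≡ + r ⊎ z ≡ - + r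
  ∣∣≡⇒≡± (+ n) refl = inj₁ refl
  ∣∣≡⇒≡± -[1+ n ] refl = inj₂ refl

  avoids⇒inS : ∀ {r n} (y : Vec ℤ n) → All (Avoids (+ r)) y → All (InS r) (Vec.map ∣_∣ y)
  avoids⇒inS y avoids = All.map⁺ (All.map avoid avoids)
    where
    avoid : ∀ {r z} → Avoids (+ r) z → ∣ z ∣ ≢ r
    avoid {z = z} (z≢r , z≢-r) ∣z∣≡r with ∣∣≡⇒≡± z ∣z∣≡r
    ... | inj₁ z≡r = z≢r z≡r
    ... | inj₂ z≡-r = z≢-r z≡-r

  fourSquares⇒sumOfSquares : ∀ {r n} (y : Vec ℤ 4) → All (InS r) (Vec.map ∣_∣ y) → norm y ≡ + n → SumOfSquares r 4 n
  fourSquares⇒sumOfSquares y inS y²≡n = Vec.map ∣_∣ y , inS , ℤ.+-injective (trans (sym (norm-ℕ y)) y²≡n)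

  isolate-entry : ∀ {r n} (x : Vec ℤ 4) → norm x ≡ + n → ¬ All (λ z → ∣ z ∣ ≢ r) x →
    ∃₂ λ b c → ∃ λ d → + r * + r + b * b + c * c + d * d ≡ + n
  isolate-entry {r} (a ∷ b ∷ c ∷ d ∷ []) x²≡n hits with ∣ a ∣ ℕ.≟ r | ∣ b ∣ ℕ.≟ r | ∣ c ∣ ℕ.≟ r | ∣ d ∣ ℕ.≟ r
  ... | no a≢r | no b≢r | no c≢r | no d≢r = contradiction (a≢r ∷ b≢r ∷ c≢r ∷ d≢r ∷ []) hits
  ... | yes refl | _ | _ | _ = b , c , d , trans (cong (λ z → z + b * b + c * c + d * d) (sym (square-∣∣ a))) (trans (lemma a b c d) x²≡n)
    where lemma : ∀ a b c d → a * a + b * b + c * c + d * d ≡ a * a + (b * b + (c * c + (d * d + 0ℤ)))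
          lemma = solve-∀
  ... | _ | yes refl | _ | _ = a , c , d , trans (cong (λ z → z + a * a + c * c + d * d) (sym (square-∣∣ b))) (trans (lemma a b c d) x²≡n)
    where lemma : ∀ a b c d → b * b + a * a + c * c + d * d ≡ a * a + (b * b + (c * c + (d * d + 0ℤ)))
          lemma = solve-∀
  ... | _ | _ | yes refl | _ = a , b , d , trans (cong (λ z → z + a * a + b * b + d * d) (sym (square-∣∣ c))) (trans (lemma a b c d) x²≡n)
    where lemma : ∀ a b c d → c * c + a * a + b * b + d * d ≡ a * a + (b * b + (c * c + (d * d + 0ℤ)))
          lemma = solve-∀
  ... | _ | _ | _ | yes refl = a , b , c , trans (cong (λ z → z + a * a + b * b + c * c) (sym (square-∣∣ d))) (trans (lemma a b c d) x²≡n)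
    where lemma : ∀ a b c d → d * d + a * a + b * b + c * c ≡ a * a + (b * b + (c * c + (d * d + 0ℤ)))
          lemma = solve-∀

  sum-four-squares : ∀ a n → n ≢ 14 ℕ.* (2 ^ suc a ℕ.* 2 ^ suc a) → SumOfSquares (3 ℕ.* 2 ^ suc a) 4 n
  sum-four-squares a n n≢ with lagrange n
  ... | x , x²≡n with All.all? (λ z → ¬? (∣ z ∣ ℕ.≟ 3 ℕ.* 2 ^ suc a)) x
  ...   | yes avoids = fourSquares⇒sumOfSquares x (All.map⁺ avoids) x²≡n
  ...   | no hits = conclude (subst₂ Outcome (sym r≡6q)
            (trans (cong (λ z → z * z + b * b + c * c + d * d) (sym r≡6q)) eq) (replaceable b c d))
    where
    r = 3 ℕ.* 2 ^ suc a
    q = 2 ^ a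
    r≡6q : + r ≡ + 6 * + q
    r≡6q = trans (cong +_ (lemma q)) (ℤ.pos-* 6 q)
      where lemma : ∀ q → 3 ℕ.* (2 ℕ.* q) ≡ 6 ℕ.* q
            lemma = ℕ-Ring.solve-∀
    q≢0 : + q ≢ 0ℤ
    q≢0 eq = ℕ.<⇒≢ (ℕ.m^n>0 2 a) (sym (ℤ.+-injective eq))
    open Replace (+ q) q≢0 (unit₃-2^ a) using (replaceable)
    found = isolate-entry x x²≡n hits
    b = proj₁ found
    c = proj₁ (proj₂ found)
    d = proj₁ (proj₂ (proj₂ found))
    eq = proj₂ (proj₂ (proj₂ found))
    conclude : Outcome (+ r) (+ n) → SumOfSquares r 4 n
    conclude (inj₁ (y , avoids , y²≡n)) = fourSquares⇒sumOfSquares y (avoids⇒inS y avoids) y²≡n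
    -- As `r` is 3 times a power of 2, cancelling 9 leaves exactly the excluded `n`.
    conclude (inj₂ 9n≡14r²) = contradiction (ℕ.*-cancelˡ-≡ n _ 9 (trans 9n≡14r²ℕ (lemma (2 ^ suc a)))) n≢
      where
      lemma : ∀ s → 14 ℕ.* (3 ℕ.* s ℕ.* (3 ℕ.* s)) ≡ 9 ℕ.* (14 ℕ.* (s ℕ.* s))
      lemma = ℕ-Ring.solve-∀
      9n≡14r²ℕ : 9 ℕ.* n ≡ 14 ℕ.* (r ℕ.* r)
      9n≡14r²ℕ = ℤ.+-injective (begin
        + (9 ℕ.* n)           ≡⟨ ℤ.pos-* 9 n ⟩
        + 9 * + n             ≡⟨ 9n≡14r² ⟩
        + 14 * (+ r * + r)    ≡⟨ cong (+ 14 *_) (ℤ.pos-* r r) ⟨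
        + 14 * + (r ℕ.* r)    ≡⟨ ℤ.pos-* 14 (r ℕ.* r) ⟨
        + (14 ℕ.* (r ℕ.* r))  ∎)
        where open ≡-Reasoning

-- The exceptional number

open Replacement using (sum-four-squares)
open import Data.Nat using (_+_; _*_)
open import Data.Nat.Divisibility using (_∣_; _∣?_)
open import Data.Nat.Tactic.RingSolver using (solve-∀)

sum-five-squares : ∀ s .{{_ : NonZero s}} → SumOfSquares (3 * s) 5 (14 * (s * s))
sum-five-squares s = (2 * s ∷ 2 * s ∷ 2 * s ∷ 1 * s ∷ 1 * s ∷ []) ,
  (2s≢3s ∷ 2s≢3s ∷ 2s≢3s ∷ s≢3s ∷ s≢3s ∷ []) , lemma s
  where
  2s≢3s : 2 * s ≢ 3 * s
  2s≢3s eq = contradiction (ℕ.*-cancelʳ-≡ 2 3 s eq) λ ()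
  s≢3s : 1 * s ≢ 3 * s
  s≢3s eq = contradiction (ℕ.*-cancelʳ-≡ 1 3 s eq) λ ()
  lemma : ∀ s → let q = λ c → c * s * (c * s) in
    q 2 + (q 2 + (q 2 + (q 1 + (q 1 + 0)))) ≡ 14 * (s * s)
  lemma = solve-∀

-- Modulo 8 an odd square is 1 and an even one is 0 or 4. One or three odd entries give an odd sum,
-- two give 2 or 6, four give 4. Residues modulo 4 determine squares modulo 8, so 256 cases suffice.
residues-even : ∀ (i j k l : Fin 4) → let r = toℕ in
  8 ∣ sumSq (r i ∷ r j ∷ r k ∷ r l ∷ []) → 2 ∣ r i × 2 ∣ r j × 2 ∣ r k × 2 ∣ r l
residues-even = from-yes (Fin.all? λ (i : Fin 4) → Fin.all? λ (j : Fin 4) → Fin.all? λ (k : Fin 4) → Fin.all? λ (l : Fin 4) →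
  8 ∣? sumSq (toℕ i ∷ toℕ j ∷ toℕ k ∷ toℕ l ∷ []) →-dec
  (2 ∣? toℕ i ×-dec 2 ∣? toℕ j ×-dec 2 ∣? toℕ k ×-dec 2 ∣? toℕ l))

-- Since `(r + 4a)² = r² + 8(ar + 2a²)`.
drop-quotients : ∀ r₁ r₂ r₃ r₄ a b c d →
  8 ∣ sumSq (r₁ + a * 4 ∷ r₂ + b * 4 ∷ r₃ + c * 4 ∷ r₄ + d * 4 ∷ []) →
  8 ∣ sumSq (r₁ ∷ r₂ ∷ r₃ ∷ r₄ ∷ [])
drop-quotients r₁ r₂ r₃ r₄ a b c d 8∣ = ℕ.∣m+n∣m⇒∣n
  (subst (8 ∣_) (trans (cong₂ _+_ (square r₁ a) (cong₂ _+_ (square r₂ b) (cong₂ _+_ (square r₃ c) (cong (_+ 0) (square r₄ d)))))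
     (regroup (K r₁ a) (K r₂ b) (K r₃ c) (K r₄ d) (r₁ * r₁) (r₂ * r₂) (r₃ * r₃) (r₄ * r₄))) 8∣)
  (ℕ.m∣m*n (K r₁ a + K r₂ b + K r₃ c + K r₄ d))
  where
  K : ℕ → ℕ → ℕ
  K r a = a * r + 2 * a * a
  square : ∀ r a → (r + a * 4) * (r + a * 4) ≡ 8 * (a * r + 2 * a * a) + r * r
  square = solve-∀
  regroup : ∀ i j k l a b c d → 8 * i + a + (8 * j + b + (8 * k + c + (8 * l + d + 0))) ≡
    8 * (i + j + k + l) + (a + (b + (c + (d + 0))))
  regroup = solve-∀

double : ∀ {r} a → 2 ∣ r → ∃ λ h → r + a * 4 ≡ 2 * h
double a (ℕ.divides k refl) = k + a * 2 , lemma k a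
  where lemma : ∀ k a → k * 2 + a * 4 ≡ 2 * (k + a * 2)
        lemma = solve-∀

halve-residues : ∀ (i j k l : Fin 4) a b c d →
  let x = toℕ i + a * 4 ∷ toℕ j + b * 4 ∷ toℕ k + c * 4 ∷ toℕ l + d * 4 ∷ [] in
  8 ∣ sumSq x → ∃ λ y → x ≡ Vec.map (2 *_) y
halve-residues i j k l a b c d 8∣ =
  let i-even , j-even , k-even , l-even = residues-even i j k l (drop-quotients (toℕ i) (toℕ j) (toℕ k) (toℕ l) a b c d 8∣)
      h₁ , eq₁ = double a i-even
      h₂ , eq₂ = double b j-even
      h₃ , eq₃ = double c k-even
      h₄ , eq₄ = double d l-even
  in h₁ ∷ h₂ ∷ h₃ ∷ h₄ ∷ [] , cong₂ _∷_ eq₁ (cong₂ _∷_ eq₂ (cong₂ _∷_ eq₃ (cong (_∷ []) eq₄)))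

halve : ∀ (x : Vec ℕ 4) → 8 ∣ sumSq x → ∃ λ y → x ≡ Vec.map (2 *_) y
halve (a ∷ b ∷ c ∷ d ∷ []) 8∣ with a ℕ.divMod 4 | b ℕ.divMod 4 | c ℕ.divMod 4 | d ℕ.divMod 4
... | ℕ.result a′ i refl | ℕ.result b′ j refl | ℕ.result c′ k refl | ℕ.result d′ l refl =
  halve-residues i j k l a′ b′ c′ d′ 8∣

sumSq-double : ∀ {n} (y : Vec ℕ n) → sumSq (Vec.map (2 *_) y) ≡ 4 * sumSq y
sumSq-double [] = refl
sumSq-double (a ∷ y) rewrite sumSq-double y = lemma a (sumSq y)
  where lemma : ∀ a s → 2 * a * (2 * a) + 4 * s ≡ 4 * (a * a + s)
        lemma = solve-∀

-- An entry other than 3 whose square is at most 14 is 0, 1 or 2, which leaves 81 sums to inspect.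
not-four-squares-14 : ∀ (x : Vec ℕ 4) → sumSq x ≡ 14 → ¬ All (InS 3) x
not-four-squares-14 (a ∷ b ∷ c ∷ d ∷ []) eq (a≢3 ∷ b≢3 ∷ c≢3 ∷ d≢3 ∷ []) =
  digits (digit a a≢3 (ℕ.m+n≤o⇒m≤o (a * a) (ℕ.≤-reflexive eq)))
         (digit b b≢3 (ℕ.m+n≤o⇒m≤o (b * b) rest₁))
         (digit c c≢3 (ℕ.m+n≤o⇒m≤o (c * c) rest₂))
         (digit d d≢3 (ℕ.m+n≤o⇒m≤o (d * d) rest₃)) eq
  where
  rest₁ = ℕ.m+n≤o⇒n≤o (a * a) (ℕ.≤-reflexive eq)
  rest₂ = ℕ.m+n≤o⇒n≤o (b * b) rest₁
  rest₃ = ℕ.m+n≤o⇒n≤o (c * c) rest₂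
  digit : ∀ z → z ≢ 3 → z * z ≤ 14 → ∃ λ (i : Fin 3) → toℕ i ≡ z
  digit 0 _ _ = Fin.zero , refl
  digit 1 _ _ = Fin.suc Fin.zero , refl
  digit 2 _ _ = Fin.suc (Fin.suc Fin.zero) , refl
  digit 3 z≢3 _ = contradiction refl z≢3
  digit z@(suc (suc (suc (suc _)))) _ z²≤14 =
    contradiction (ℕ.≤-trans (ℕ.*-mono-≤ 4≤z 4≤z) z²≤14) (ℕ.<⇒≱ (ℕ.m≤m+n 15 1))
    where
    4≤z : 4 ≤ z
    4≤z = s≤s (s≤s (s≤s (s≤s z≤n)))
  no-digits : ∀ (i j k l : Fin 3) → sumSq (toℕ i ∷ toℕ j ∷ toℕ k ∷ toℕ l ∷ []) ≢ 14
  no-digits = from-yes (Fin.all? λ (i : Fin 3) → Fin.all? λ (j : Fin 3) → Fin.all? λ (k : Fin 3) → Fin.all? λ (l : Fin 3) →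
    ¬? (sumSq (toℕ i ∷ toℕ j ∷ toℕ k ∷ toℕ l ∷ []) ℕ.≟ 14))
  digits : ∀ {a b c d} → ∃ (λ (i : Fin 3) → toℕ i ≡ a) → ∃ (λ (i : Fin 3) → toℕ i ≡ b) →
    ∃ (λ (i : Fin 3) → toℕ i ≡ c) → ∃ (λ (i : Fin 3) → toℕ i ≡ d) → sumSq (a ∷ b ∷ c ∷ d ∷ []) ≢ 14
  digits (i , refl) (j , refl) (k , refl) (l , refl) = no-digits i j k l

not-four-squares : ∀ b (x : Vec ℕ 4) → sumSq x ≡ 14 * (2 ^ b * 2 ^ b) → ¬ All (InS (3 * 2 ^ b)) x
not-four-squares zero = not-four-squares-14
-- The factor 4 gained over the base case makes the sum `56 s²`, a multiple of 8, so the
-- representation is twice one of `14 s²`. An entry `3 s` there would be the forbidden `3 (2 s)`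
-- here.
not-four-squares (suc b) x eq = halved (halve x (ℕ.divides (7 * (s * s)) (trans eq (eighth s)))) eq
  where
  s = 2 ^ b
  eighth : ∀ s → 14 * (2 * s * (2 * s)) ≡ 7 * (s * s) * 8
  eighth = solve-∀
  quarter : ∀ s → 14 * (2 * s * (2 * s)) ≡ 4 * (14 * (s * s))
  quarter = solve-∀
  commute : ∀ s → 2 * (3 * s) ≡ 3 * (2 * s)
  commute = solve-∀
  halved : ∀ {x} → (∃ λ y → x ≡ Vec.map (2 *_) y) →
    sumSq x ≡ 14 * (2 * s * (2 * s)) → ¬ All (InS (3 * (2 * s))) x
  halved (y , refl) eq inS = not-four-squares b y
    (ℕ.*-cancelˡ-≡ (sumSq y) (14 * (s * s)) 4 (trans (sym (sumSq-double y)) (trans eq (quarter s))))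
    (All.map (λ 2z≢ z≡ → 2z≢ (trans (cong (2 *_) z≡) (commute s))) (All.map⁻ inS))

-- Because 0 is an admissible entry, excluding four squares also excludes fewer.
pad : ∀ {ρ m n} → 0 ≢ ρ → SumOfSquares ρ m n → SumOfSquares ρ (suc m) n
pad 0≢ρ (x , inS , eq) = 0 ∷ x , 0≢ρ ∷ inS , eq

theorem3p3 : (a : ℕ) →
    ((n : ℕ) → 1 ≤ n → n ≢ 14 * 2 ^ (2 * a + 2) → SumOfSquares (3 * 2 ^ (a + 1)) 4 n)
    × SumOfSquares (3 * 2 ^ (a + 1)) 5 (14 * 2 ^ (2 * a + 2))
    × HasM (3 * 2 ^ (a + 1)) 5
-- The argument is carried out with `suc a` and `s * s`, where `s = 2 ^ suc a`, and transported to
-- the exponents `a + 1` and `2 * a + 2`.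
theorem3p3 a = subst₂ (λ b s → let ρ = 3 * 2 ^ b ; e = 14 * s in
    (∀ n → 1 ≤ n → n ≢ e → SumOfSquares ρ 4 n) × SumOfSquares ρ 5 e × HasM ρ 5)
  (ℕ.+-comm 1 a) (sym (trans (cong (2 ^_) (lemma a)) (ℕ.^-distribˡ-+-* 2 (suc a) (suc a))))
  ((λ n _ → sum-four-squares a n) , five , (e , e>0 , s≤s z≤n , five , minimal) , bound)
  where
  lemma : ∀ a → 2 * a + 2 ≡ suc a + suc a
  lemma = solve-∀
  s = 2 ^ suc a
  instance _ = ℕ.m^n≢0 2 (suc a)
  e = 14 * (s * s)
  five : SumOfSquares (3 * s) 5 e
  five = sum-five-squares s
  e>0 : 1 ≤ e
  e>0 = ℕ.>-nonZero⁻¹ e {{ℕ.m*n≢0 14 (s * s) {{_}} {{ℕ.m*n≢0 s s}}}}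
  0≢ρ : 0 ≢ 3 * s
  0≢ρ = ℕ.≢-nonZero⁻¹ (3 * s) {{ℕ.m*n≢0 3 s}} ∘ sym
  ¬four : ¬ SumOfSquares (3 * s) 4 e
  ¬four (x , inS , eq) = not-four-squares (suc a) x eq inS
  minimal : ∀ m → 1 ≤ m → m < 5 → ¬ SumOfSquares (3 * s) m e
  minimal 1 _ _ = ¬four ∘ pad 0≢ρ ∘ pad 0≢ρ ∘ pad 0≢ρ
  minimal 2 _ _ = ¬four ∘ pad 0≢ρ ∘ pad 0≢ρ
  minimal 3 _ _ = ¬four ∘ pad 0≢ρ
  minimal 4 _ _ = ¬four
  minimal (suc (suc (suc (suc (suc _))))) _ (s≤s (s≤s (s≤s (s≤s (s≤s ())))))
  bound : ∀ n k → 1 ≤ n → HasK (3 * s) n k → k ≤ 5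
  -- A least number of squares above 5 would contradict the five squares for `e`, or the four
  -- squares for any other `n`.
  bound n k _ (_ , _ , least) with k ℕ.≤? 5 | n ℕ.≟ e
  ... | yes k≤5 | _ = k≤5
  ... | no k≰5 | yes refl = contradiction five (least 5 (s≤s z≤n) (ℕ.≰⇒> k≰5))
  ... | no k≰5 | no n≢e = contradiction (sum-four-squares a n n≢e) (least 4 (s≤s z≤n) (ℕ.<-trans (ℕ.n<1+n 4) (ℕ.≰⇒> k≰5)))
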